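{- Let $d\ge4$ be even and let $\mathcal{T}$ be a $\mathcal{G}_{n,d}$-tangle of order $r\ge0$. Then the expected number of occurrences of $\mathcal{T}$ in a random $G\in\mathcal{G}_{n,d}$ is $n^{ -r}+O(n^{ -r-1})$ as $n\to\infty$, and the probability that $\mathcal{T}$ occurs at least once in $G$ is at least $n^{ -r}/c-n^{ -2r}/(2c^2)+O(n^{ -r-1})$, where $c$ is the number of automorphisms (label-preserving) of the complete pruning of $\mathcal{T}$.
   Context: $\mathcal{G}_{n,d}$: choose independent uniformly random permutations $\pi_1,\dots,\pi_{d/2}$ of $\{1,\dots,n\}$. The graph $G$ on $\{1,\dots,n\}$ has, for each $j$ and $i$, a directed edge $i\to\pi_j(i)$ labelled $\pi_j$ paired with its reverse $\pi_j(i)\to i$ labelled $\pi_j^{ -1}$ (a fixed point gives a whole-loop). So $G$ is $\Pi$-labelled, $\Pi=\{\pi_1,\pi_1^{ -1},\dots,\pi_{d/2},\pi_{d/2}^{ -1}\}$, with reverse edges carrying inverse labels. A labelled graph $H$ occurs in (is contained in) $G$ via a map $\iota$ if $\iota$ is a label-preserving graph homomorphism injective on vertices and edges; the number of occurrences is the number of such $\iota$. A $\mathcal{G}_{n,d}$-tangle is a connected $\Pi$-labelled graph contained in some graph of $\mathcal{G}_{n,d}$ for some $n$. The order of a graph is (number of undirected edges) $-$ (number of vertices), each self-loop counting as one edge. A leaf is a vertex of degree $1$; a complete pruning repeatedly deletes leaves with their incident edges until none remain (the result is unique). -}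

module Defs where

open import Data.Nat using (ℕ; zero; suc; _+_; _*_; _^_; _≤_; _≤?_)
open import Data.Fin using (Fin; zero; suc)
import Data.Fin as Fin
open import Data.Fin.Properties using (all?)
open import Data.Bool using (Bool; true; false; _∧_; not; if_then_else_)
import Data.Bool.Properties as BoolP
open import Data.Nat.ListAction using (sum)
open import Data.List using (List; []; _∷_; [_]; map; concatMap; filter; length; allFin; cartesianProduct)
open import Data.Product using (Σ; ∃; ∃-syntax; _×_; _,_; proj₁; proj₂)
import Data.Product.Properties as ProdP
open import Relation.Binary.PropositionalEquality using (_≡_)
open import Relation.Nullary using (Dec; yes; no)
open import Relation.Nullary.Decidable using (⌊_⌋; _×-dec_; _→-dec_)
open import Data.Integer using (+_)
open import Data.Rational using (ℚ; _/_; 0ℚ)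

-- Π-labelled graphs, Π = {π₁,π₁⁻¹,…,π_k,π_k⁻¹}, k = d/2.
-- Vertices Fin nV; undirected edges Fin nE.  Edge ε stands for the
-- directed edge  src ε → tgt ε  labelled π_(lab ε)  together with its
-- reverse  tgt ε → src ε  labelled π_(lab ε)⁻¹.  (src ε ≡ tgt ε is a
-- whole-loop, counting as one edge.)  Parallel edges are allowed.

record LGraph (k : ℕ) : Set where
  field
    nV nE : ℕ
    src tgt : Fin nE → Fin nV
    lab : Fin nE → Fin k
open LGraph public

Injective : ∀ {a} {A : Set a} {m : ℕ} → (Fin m → A) → Set a
Injective f = ∀ x y → f x ≡ f y → x ≡ y

-- A tuple of k maps Fin n → Fin n; it is a point of 𝒢_{n,2k} when each is a
-- permutation (injective self-map of a finite set).
Tuple : ℕ → ℕ → Set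
Tuple n k = Fin k → Fin n → Fin n

IsPermTuple : ∀ {n k} → Tuple n k → Set
IsPermTuple σ = ∀ j → Injective (σ j)

-- The graph G(σ): vertex set Fin n, undirected edges Fin n × Fin k, the edge
-- (i , j) being  i → σ j i  labelled π_j (with reverse labelled π_j⁻¹).
-- An occurrence of H in G(σ): a vertex map φ and an edge map ψ, both
-- injective, forming a label-preserving homomorphism.
IsOcc : ∀ {n k} → Tuple n k → (H : LGraph k) →
        (Fin (nV H) → Fin n) → (Fin (nE H) → Fin n × Fin k) → Set
IsOcc σ H φ ψ =
  Injective φ × Injective ψ ×
  (∀ ε → proj₁ (ψ ε) ≡ φ (src H ε)
       × proj₂ (ψ ε) ≡ lab H ε
       × σ (proj₂ (ψ ε)) (proj₁ (ψ ε)) ≡ φ (tgt H ε))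

injective? : ∀ {a} {A : Set a} {m : ℕ} → ((x y : A) → Dec (x ≡ y)) →
             (f : Fin m → A) → Dec (Injective f)
injective? _≟A_ f = all? (λ x → all? (λ y → (f x ≟A f y) →-dec (x Fin.≟ y)))

pair≟ : ∀ {n k} (x y : Fin n × Fin k) → Dec (x ≡ y)
pair≟ = ProdP.≡-dec Fin._≟_ Fin._≟_

isOcc? : ∀ {n k} (σ : Tuple n k) (H : LGraph k) →
         (p : (Fin (nV H) → Fin n) × (Fin (nE H) → Fin n × Fin k)) →
         Dec (IsOcc σ H (proj₁ p) (proj₂ p))
isOcc? σ H (φ , ψ) =
  injective? Fin._≟_ φ ×-dec injective? pair≟ ψ ×-dec
  all? (λ ε → (proj₁ (ψ ε) Fin.≟ φ (src H ε))
          ×-dec (proj₂ (ψ ε) Fin.≟ lab H ε)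
          ×-dec (σ (proj₂ (ψ ε)) (proj₁ (ψ ε)) Fin.≟ φ (tgt H ε)))

consF : ∀ {a} {A : Set a} {m : ℕ} → A → (Fin m → A) → Fin (suc m) → A
consF x f zero    = x
consF x f (suc i) = f i

funs : ∀ {a} {A : Set a} → List A → (m : ℕ) → List (Fin m → A)
funs xs zero    = [ (λ ()) ]
funs xs (suc m) = concatMap (λ x → map (consF x) (funs xs m)) xs

allEdges : (n k : ℕ) → List (Fin n × Fin k)
allEdges n k = cartesianProduct (allFin n) (allFin k)

occurrences : ∀ {n k} → Tuple n k → LGraph k → ℕ
occurrences {n} {k} σ H =
  length (filter (isOcc? σ H)
    (cartesianProduct (funs (allFin n) (nV H)) (funs (allEdges n k) (nE H))))

allPerms : (n : ℕ) → List (Fin n → Fin n)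
allPerms n = filter (injective? Fin._≟_) (funs (allFin n) n)

allTuples : (n k : ℕ) → List (Tuple n k)
allTuples n k = funs (allPerms n) k

-- a / b as a rational (b is always ≥ 1 where used; 0 if b = 0)
ratio : ℕ → ℕ → ℚ
ratio a zero    = 0ℚ
ratio a (suc b) = (+ a) / suc b

expectedOcc : ∀ {k} → LGraph k → ℕ → ℚ
expectedOcc {k} H n =
  ratio (sum (map (λ σ → occurrences σ H) (allTuples n k))) (length (allTuples n k))

probOcc : ∀ {k} → LGraph k → ℕ → ℚ
probOcc {k} H n =
  ratio (length (filter (λ σ → 1 ≤? occurrences σ H) (allTuples n k)))
        (length (allTuples n k))

data Walk {k} (H : LGraph k) : Fin (nV H) → Fin (nV H) → Set where
  here : ∀ {x} → Walk H x x
  fwd  : ∀ ε {y} → Walk H (tgt H ε) y → Walk H (src H ε) y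
  bwd  : ∀ ε {y} → Walk H (src H ε) y → Walk H (tgt H ε) y

Connected : ∀ {k} → LGraph k → Set
Connected H = ∀ x y → Walk H x y

ContainedInSome : ∀ {k} → LGraph k → Set
ContainedInSome {k} H =
  ∃[ n ] ∃[ σ ] (IsPermTuple {n} {k} σ ×
    ∃[ φ ] ∃[ ψ ] IsOcc σ H φ ψ)

IsTangle : ∀ {k} → LGraph k → Set
IsTangle H = Connected H × ContainedInSome H

-- Complete pruning, as a subgraph (kept vertices, kept edges).

countB : ∀ {m} → (Fin m → Bool) → ℕ
countB {zero}  p = 0
countB {suc m} p = (if p zero then 1 else 0) + countB (λ i → p (suc i))

SubG : ∀ {k} → LGraph k → Set
SubG H = (Fin (nV H) → Bool) × (Fin (nE H) → Bool)

-- degree of x in the subgraph (a loop contributes 2)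
degree : ∀ {k} (H : LGraph k) → SubG H → Fin (nV H) → ℕ
degree H (KV , KE) x =
  countB (λ ε → KE ε ∧ ⌊ src H ε Fin.≟ x ⌋) + countB (λ ε → KE ε ∧ ⌊ tgt H ε Fin.≟ x ⌋)

isLeaf : ∀ {k} (H : LGraph k) → SubG H → Fin (nV H) → Bool
isLeaf H S@(KV , KE) x = KV x ∧ ⌊ degree H S x Data.Nat.≟ 1 ⌋

pruneStep : ∀ {k} (H : LGraph k) → SubG H → SubG H
pruneStep H S@(KV , KE) =
  (λ x → KV x ∧ not (isLeaf H S x)) ,
  (λ ε → KE ε ∧ not (isLeaf H S (src H ε)) ∧ not (isLeaf H S (tgt H ε)))

iter : ∀ {A : Set} → ℕ → (A → A) → A → A
iter zero    f a = a
iter (suc m) f a = iter m f (f a)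

-- nV rounds suffice: each non-final round removes a vertex.
completePruning : ∀ {k} (H : LGraph k) → SubG H
completePruning H = iter (nV H) (pruneStep H) ((λ _ → true) , (λ _ → true))

-- Label-preserving automorphisms of the subgraph S, encoded as pairs of
-- self-maps of Fin nV, Fin nE that are the identity off S, preserve S,
-- are injective, and are label-preserving homomorphisms on S.
IsAut : ∀ {k} (H : LGraph k) → SubG H →
        (Fin (nV H) → Fin (nV H)) → (Fin (nE H) → Fin (nE H)) → Set
IsAut H (KV , KE) φ ψ =
  (∀ x → KV x ≡ false → φ x ≡ x) × (∀ ε → KE ε ≡ false → ψ ε ≡ ε) ×
  (∀ x → KV x ≡ true → KV (φ x) ≡ true) × (∀ ε → KE ε ≡ true → KE (ψ ε) ≡ true) ×
  Injective φ × Injective ψ ×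
  (∀ ε → KE ε ≡ true →
     src H (ψ ε) ≡ φ (src H ε) × tgt H (ψ ε) ≡ φ (tgt H ε) × lab H (ψ ε) ≡ lab H ε)

isAut? : ∀ {k} (H : LGraph k) (S : SubG H) →
         (p : (Fin (nV H) → Fin (nV H)) × (Fin (nE H) → Fin (nE H))) →
         Dec (IsAut H S (proj₁ p) (proj₂ p))
isAut? H (KV , KE) (φ , ψ) =
  all? (λ x → (KV x BoolP.≟ false) →-dec (φ x Fin.≟ x)) ×-dec
  all? (λ ε → (KE ε BoolP.≟ false) →-dec (ψ ε Fin.≟ ε)) ×-dec
  all? (λ x → (KV x BoolP.≟ true) →-dec (KV (φ x) BoolP.≟ true)) ×-dec
  all? (λ ε → (KE ε BoolP.≟ true) →-dec (KE (ψ ε) BoolP.≟ true)) ×-dec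
  injective? Fin._≟_ φ ×-dec injective? Fin._≟_ ψ ×-dec
  all? (λ ε → (KE ε BoolP.≟ true) →-dec
     ((src H (ψ ε) Fin.≟ φ (src H ε)) ×-dec (tgt H (ψ ε) Fin.≟ φ (tgt H ε))
       ×-dec (lab H (ψ ε) Fin.≟ lab H ε)))

autCount : ∀ {k} (H : LGraph k) → SubG H → ℕ
autCount H S =
  length (filter (isAut? H S)
    (cartesianProduct (funs (allFin (nV H)) (nV H)) (funs (allFin (nE H)) (nE H))))

pruningAutCount : ∀ {k} → LGraph k → ℕ
pruningAutCount H = autCount H (completePruning H)

invPow : ℕ → ℕ → ℚ
invPow n m = ratio 1 (n ^ m)

-- Let v and e be the numbers of vertices and edges of T, so e = r + v, and let
-- M be the number of permutation tuples.
--
-- First moment.  Given an injective vertex map, T occurs along it when e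
-- prescribed values of the permutations are taken.  Composing a permutation
-- with a transposition of its values shows that each further prescription
-- divides the number of admissible tuples by between n - e and n, so the
-- expectation lies between (n - v)^v / n^e and n^v / (n - e)^e.
--
-- Second moment.  Call two occurrences equivalent if they have the same image
-- of the core (the complete pruning).  An equivalence class has at most c
-- members, because φ⁻¹ ∘ φ′ restricts to an automorphism of the core and
-- determines φ′.  A Bonferroni inequality for classes of size at most c bounds
-- the probability below by E[X]/c - E[D]/(2c²), with X the number of
-- occurrences and D that of ordered nonequivalent pairs.  Disjoint pairs are
-- occurrences of two copies of T and contribute n^(-2r) + O(n^(-2r-1)).  In a
-- nonequivalent pair that meets, one of the two occurrences uses an edge outside
-- the other whose ends can both be located without it.  That edge can be
-- redirected in about n ways keeping the other occurrence, so such pairs are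
-- rarer than occurrences by a factor O(1/n).
module Submission where

open import Defs
open import Data.Nat using (ℕ; zero; suc; _+_; _*_; _^_; _∸_; _≤_; _<_; _≤?_; z≤n; s≤s; NonZero)
open import Data.Nat.Properties
open import Data.Nat.ListAction using (sum)
open import Data.Nat.Tactic.RingSolver using (solve-∀)
open import Data.Bool using (Bool; true; false; _∧_; not; if_then_else_)
import Data.Bool.Properties as BoolP
open import Data.Fin using (Fin; zero; suc; _↑ˡ_; _↑ʳ_; splitAt)
import Data.Fin as Fin
import Data.Fin.Properties as FinP
open import Data.Fin.Properties using (all?; any?)
open import Data.Fin.Permutation.Components using (transpose; transpose-inverse)
open import Data.List using (List; []; _∷_; map; concatMap; filter; length; allFin; cartesianProduct; _++_; lookup; tabulate)
open import Data.List.Properties using (length-map; length-++; length-tabulate; filter-all; length-filter)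
open import Data.List.Membership.Propositional using (_∈_; _∉_; find; lose)
open import Data.List.Membership.Propositional.Properties
open import Data.List.Relation.Unary.All as All using (All; []; _∷_)
import Data.List.Relation.Unary.All.Properties as AllP
open import Data.List.Relation.Unary.Any as Any using (Any; here; there)
open import Data.List.Relation.Unary.Any.Properties using (lookup-index)
open import Data.List.Relation.Unary.AllPairs using (AllPairs; []; _∷_)
import Data.List.Relation.Unary.AllPairs as AllPairs
import Data.List.Relation.Unary.AllPairs.Properties as AllPairsP
open import Data.Product using (∃; ∃-syntax; Σ; _×_; _,_; proj₁; proj₂)
open import Data.Sum using (_⊎_; inj₁; inj₂; [_,_])
open import Data.Unit using (⊤; tt)
open import Data.Empty using (⊥; ⊥-elim)
open import Function using (_∘_)
open import Relation.Nullary using (¬_; Dec; yes; no; contradiction)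
open import Relation.Nullary.Decidable using (¬?; _×-dec_; _⊎-dec_; _→-dec_; ⌊_⌋; map′)
open import Relation.Unary using (Decidable)
open import Relation.Binary.PropositionalEquality using (_≡_; _≢_; refl; sym; trans; cong; cong₂; subst; subst₂; _≗_; module ≡-Reasoning)
open import Relation.Binary.Definitions using (tri<; tri≈; tri>)
open import Algebra.Properties.Semiring.Sum +-*-semiring using (sum-cong-≗; ∑-comm; ∑-distrib-+; *-distribˡ-sum) renaming (sum to ∑)
import Data.Sum.Properties as SumP
open import Data.Sum.Properties using (inj₁-injective; inj₂-injective)
open import Data.Rational using (ℚ; 0ℚ; ∣_∣; toℚᵘ) renaming (_+_ to _+ℚ_; _-_ to _-ℚ_; _*_ to _*ℚ_; _≤_ to _≤ℚ_; -_ to -ℚ_)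
import Data.Rational.Properties as ℚP
import Data.Rational.Unnormalised as ℚᵘ
import Data.Rational.Unnormalised.Properties as ℚᵘP
import Data.Integer as ℤ
import Data.Integer.Properties as ℤP
open import Algebra.Properties.Group ℚP.+-0-group using (⁻¹-anti-homo-//)

-- Counting finite lists by injections

-- Equivalence compares images of the core and not of `T`: two occurrences may share the core and
-- place the hanging trees differently, and such pairs need not be rarer than single occurrences, so
-- they have to fall into one class. Class sizes are bounded because a permutation leaves no choice
-- in extending an occurrence along an edge, in either direction. This needs a core edge to start
-- from, which order at least 0 provides.
--
-- A meeting pair is usually handled by listing the possible unions of two copies and showing that
-- their order exceeds `r`. Here no union is formed: one switching destroys the second occurrence,
-- and the difficulty becomes to rebuild it from the first. Hence the search for an edge whose ends
-- can be reached from the first occurrence without it; leaflessness of the core supplies one.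
--
-- All bounds are inequalities between list lengths with denominators cleared, and powers such as
-- `(n - E)^E` stand in for falling factorials. Rationals appear only at the end.

Distinct : {A : Set} → (A → A → Set) → List A → Set
Distinct _~_ = AllPairs (λ x y → ¬ (x ~ y))

lookup-AllPairs : ∀ {A : Set} {R : A → A → Set} {xs} → AllPairs R xs →
  ∀ {i j} → i Fin.< j → R (lookup xs i) (lookup xs j)
lookup-AllPairs (px ∷ _) {zero} {suc j} _ = All.lookup px (∈-lookup j)
lookup-AllPairs (_ ∷ pxs) {suc i} {suc j} (s≤s i<j) = lookup-AllPairs pxs i<j

-- Counting by injection, with the injection given as a relation because the
-- enumerated functions are only determined up to pointwise equality.
length-≤ : ∀ {A B : Set} {_≈_ : A → A → Set} (R : A → B → Set) {xs : List A} {ys : List B} →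
  Distinct _≈_ xs →
  (∀ {x} → x ∈ xs → ∃[ y ] (y ∈ ys × R x y)) →
  (∀ {x x′ y} → R x y → R x′ y → x ≈ x′) →
  length xs ≤ length ys
length-≤ {_≈_ = _≈_} R {xs} {ys} dist total inj = FinP.injective⇒≤ {f = f} f-inj
  where
  image : ∀ i → ∃[ y ] (y ∈ ys × R (lookup xs i) y)
  image i = total (∈-lookup i)
  f : Fin (length xs) → Fin (length ys)
  f i = Any.index (proj₁ (proj₂ (image i)))
  related : ∀ i → R (lookup xs i) (lookup ys (f i))
  related i = let (y , y∈ , r) = image i in subst (R _) (lookup-index y∈) r
  equal : ∀ {i j} → f i ≡ f j → lookup xs i ≈ lookup xs j
  equal {i} {j} eq = inj (related i) (subst (λ k → R _ (lookup ys k)) (sym eq) (related j))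
  f-inj : ∀ {i j} → f i ≡ f j → i ≡ j
  f-inj {i} {j} eq with FinP.<-cmp i j
  ... | tri< i<j _ _ = ⊥-elim (lookup-AllPairs dist i<j (equal eq))
  ... | tri≈ _ i≡j _ = i≡j
  ... | tri> _ _ j<i = ⊥-elim (lookup-AllPairs dist j<i (equal (sym eq)))

module _ {A B C : Set} (f : A → B → C) (g : A → List B) where

  -- One pattern for `funs`, with `f` equal to `consF`, and for dependent pairs, with `f` equal to
  -- `_,_`, so that membership, length and distinctness are treated once.
  join : List A → List C
  join = concatMap (λ x → map (f x) (g x))

  ∈-join⁺ : ∀ {xs x y} → x ∈ xs → y ∈ g x → f x y ∈ join xs
  ∈-join⁺ {x ∷ xs} (here refl) y∈ = ∈-++⁺ˡ (∈-map⁺ (f x) y∈)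
  ∈-join⁺ {x ∷ xs} (there x∈) y∈ = ∈-++⁺ʳ (map (f x) (g x)) (∈-join⁺ x∈ y∈)

  ∈-join⁻ : ∀ xs {z} → z ∈ join xs → ∃[ x ] ∃[ y ] (x ∈ xs × y ∈ g x × z ≡ f x y)
  ∈-join⁻ (x ∷ xs) z∈ with ∈-++⁻ (map (f x) (g x)) z∈
  ... | inj₁ z∈ˡ = let (y , y∈ , eq) = ∈-map⁻ (f x) z∈ˡ in x , y , here refl , y∈ , eq
  ... | inj₂ z∈ʳ = let (x′ , y , x∈ , y∈ , eq) = ∈-join⁻ xs z∈ʳ in x′ , y , there x∈ , y∈ , eq

  length-join : ∀ xs → length (join xs) ≡ sum (map (length ∘ g) xs)
  length-join [] = refl
  length-join (x ∷ xs) = trans (length-++ (map (f x) (g x)))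
    (cong₂ _+_ (length-map (f x) (g x)) (length-join xs))

  length-join-≥ : ∀ q xs → (∀ {x} → x ∈ xs → q ≤ length (g x)) → q * length xs ≤ length (join xs)
  length-join-≥ q [] _ = ≤-reflexive (*-zeroʳ q)
  length-join-≥ q (x ∷ xs) bound = begin
    q * suc (length xs)                         ≡⟨ *-suc q _ ⟩
    q + q * length xs                           ≤⟨ +-mono-≤ (bound (here refl)) (length-join-≥ q xs (bound ∘ there)) ⟩
    length (g x) + length (join xs)             ≡⟨ cong (_+ _) (length-map (f x) (g x)) ⟨
    length (map (f x) (g x)) + length (join xs) ≡⟨ length-++ (map (f x) (g x)) ⟨
    length (join (x ∷ xs))                      ∎
    where open ≤-Reasoning

  join-distinct : ∀ {_≈A_ : A → A → Set} {_≈B_ : B → B → Set} {_≈_ : C → C → Set} →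
    (∀ {x y x′ y′} → f x y ≈ f x′ y′ → x ≈A x′ × y ≈B y′) →
    ∀ {xs} → Distinct _≈A_ xs → (∀ {x} → x ∈ xs → Distinct _≈B_ (g x)) → Distinct _≈_ (join xs)
  join-distinct inj [] _ = []
  join-distinct {_≈_ = _≈_} inj {x ∷ xs} (x≉ ∷ dist) dist-g = AllPairsP.++⁺
    (AllPairsP.map⁺ (AllPairs.map (λ y≉ eq → y≉ (proj₂ (inj eq))) (dist-g (here refl))))
    (join-distinct inj dist (dist-g ∘ there))
    (AllP.map⁺ (All.tabulate (λ _ → All.tabulate (λ z∈ → cross z∈))))
    where
    cross : ∀ {y z} → z ∈ join xs → ¬ (f x y ≈ z)
    cross z∈ eq with ∈-join⁻ xs z∈
    ... | x′ , y′ , x′∈ , _ , refl = All.lookup x≉ x′∈ (proj₁ (inj eq))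

pairs : {A B : Set} → (A → List B) → List A → List (A × B)
pairs = join _,_

cartesianProduct≡pairs : ∀ {A B : Set} (xs : List A) (ys : List B) →
  cartesianProduct xs ys ≡ pairs (λ _ → ys) xs
cartesianProduct≡pairs [] ys = refl
cartesianProduct≡pairs (x ∷ xs) ys = cong (map (x ,_) ys ++_) (cartesianProduct≡pairs xs ys)

length-cartesianProduct : ∀ {A B : Set} (xs : List A) (ys : List B) →
  length (cartesianProduct xs ys) ≡ length xs * length ys
length-cartesianProduct [] ys = refl
length-cartesianProduct (x ∷ xs) ys =
  trans (length-++ (map (x ,_) ys)) (cong₂ _+_ (length-map (x ,_) ys) (length-cartesianProduct xs ys))

cartesianProduct-distinct : ∀ {A B : Set} {_≈A_ : A → A → Set} {_≈B_ : B → B → Set} {xs ys} →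
  Distinct _≈A_ xs → Distinct _≈B_ ys →
  Distinct (λ (x , y) (x′ , y′) → x ≈A x′ × y ≈B y′) (cartesianProduct xs ys)
cartesianProduct-distinct {xs = xs} {ys} dx dy rewrite cartesianProduct≡pairs xs ys =
  join-distinct _,_ (λ _ → ys) (λ eq → eq) dx (λ _ → dy)

allFin-distinct : ∀ n → Distinct _≡_ (allFin n)
allFin-distinct n = AllPairsP.tabulate⁺ (λ i≢j → i≢j)

fresh : ∀ {n} → List (Fin n) → List (Fin n)
fresh {n} ys = filter (λ b → ¬? (Any.any? (b Fin.≟_) ys)) (allFin n)

∈-fresh⁻ : ∀ {n} {ys : List (Fin n)} {b} → b ∈ fresh ys → b ∉ ys
∈-fresh⁻ {ys = ys} b∈ = proj₂ (∈-filter⁻ (λ b → ¬? (Any.any? (b Fin.≟_) ys)) {xs = allFin _} b∈)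

fresh-distinct : ∀ {n} (ys : List (Fin n)) → Distinct _≡_ (fresh ys)
fresh-distinct {n} ys = AllPairsP.filter⁺ _ (allFin-distinct n)

length-fresh : ∀ {n} (ys : List (Fin n)) {q} → length ys ≡ q → n ∸ q ≤ length (fresh ys)
length-fresh {n} ys refl = m≤n+o⇒m∸n≤o n (length ys) (begin
  n                                ≡⟨ length-tabulate {n = n} (λ i → i) ⟨
  length (allFin n)                ≤⟨ length-≤ _≡_ (allFin-distinct n) split (λ { refl refl → refl }) ⟩
  length (ys ++ fresh ys)          ≡⟨ length-++ ys ⟩
  length ys + length (fresh ys)    ∎)
  where
  open ≤-Reasoning
  split : ∀ {b} → b ∈ allFin n → ∃[ b′ ] (b′ ∈ ys ++ fresh ys × b ≡ b′)
  split {b} b∈ with Any.any? (b Fin.≟_) ys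
  ... | yes b∈ys = b , ∈-++⁺ˡ b∈ys , refl
  ... | no b∉ys = b , ∈-++⁺ʳ ys (∈-filter⁺ _ b∈ b∉ys) , refl

-- The form of most of the switching arguments: every `x` admits at least `q` modifications `b`, and
-- both `x` and `b` can be read off from the outcome `y`.
length-distinct-pairs-≤ : ∀ {A B C : Set} {_≈A_ : A → A → Set} {_≈B_ : B → B → Set} (g : A → List B)
  (R : A × B → C → Set) {q xs} {ys : List C} →
  Distinct _≈A_ xs → (∀ {x} → x ∈ xs → Distinct _≈B_ (g x)) →
  (∀ {x} → x ∈ xs → q ≤ length (g x)) →
  (∀ {x b} → x ∈ xs → b ∈ g x → ∃[ y ] (y ∈ ys × R (x , b) y)) →
  (∀ {x b x′ b′ y} → R (x , b) y → R (x′ , b′) y → x ≈A x′ × b ≈B b′) →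
  q * length xs ≤ length ys
length-distinct-pairs-≤ {_≈A_ = _≈A_} {_≈B_} g R {q} {xs} {ys} dx dg lg total inj = ≤-trans (length-join-≥ _,_ g q xs lg)
  (length-≤ {_≈_ = λ (x , b) (x′ , b′) → x ≈A x′ × b ≈B b′} R
    (join-distinct _,_ g (λ eq → eq) dx dg) total′ inj)
  where
  total′ : ∀ {z} → z ∈ pairs g xs → ∃[ y ] (y ∈ ys × R z y)
  total′ z∈ with ∈-join⁻ _,_ g xs z∈
  ... | x , b , x∈ , b∈ , refl = total x∈ b∈

-- Permutation tuples and switchings

Pointwise : {A : Set} {m : ℕ} → (A → A → Set) → (Fin m → A) → (Fin m → A) → Set
Pointwise _~_ f g = ∀ i → f i ~ g i

funs-sound : ∀ {A : Set} (xs : List A) m {f} → f ∈ funs xs m → ∀ i → f i ∈ xs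
funs-sound xs (suc m) f∈ i with ∈-join⁻ consF (λ _ → funs xs m) xs f∈
funs-sound xs (suc m) f∈ zero    | x , g , x∈ , g∈ , refl = x∈
funs-sound xs (suc m) f∈ (suc i) | x , g , x∈ , g∈ , refl = funs-sound xs m g∈ i

-- A given function need not be literally in the list, only a copy of it up to `_~_`. The relation
-- is a parameter because tuples of permutations are compared pointwise at two levels.
funs-complete : ∀ {A : Set} {_~_ : A → A → Set} (xs : List A) m (f : Fin m → A) →
  (∀ i → ∃[ x ] (x ∈ xs × f i ~ x)) → ∃[ g ] (g ∈ funs xs m × Pointwise _~_ f g)
funs-complete xs zero f _ = _ , here refl , λ ()
funs-complete {_~_ = _~_} xs (suc m) f near =
  let (x , x∈ , eq) = near zero
      (g , g∈ , eqs) = funs-complete {_~_ = _~_} xs m (f ∘ suc) (near ∘ suc)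
  in consF x g , ∈-join⁺ consF (λ _ → funs xs m) x∈ g∈ , λ { zero → eq ; (suc i) → eqs i }

funs-distinct : ∀ {A : Set} {_~_ : A → A → Set} {xs} → Distinct _~_ xs →
  ∀ m → Distinct (Pointwise _~_) (funs xs m)
funs-distinct dist zero = [] ∷ []
funs-distinct {xs = xs} dist (suc m) = join-distinct consF (λ _ → funs xs m)
  (λ eq → eq zero , eq ∘ suc) dist (λ _ → funs-distinct dist m)

length-funs : ∀ {A : Set} (xs : List A) m → length (funs xs m) ≡ length xs ^ m
length-funs xs zero = refl
length-funs xs (suc m) = trans (length-join consF (λ _ → funs xs m) xs) (constant xs)
  where
  constant : ∀ ys → sum (map (λ _ → length (funs xs m)) ys) ≡ length ys * length xs ^ m
  constant [] = refl
  constant (_ ∷ ys) = cong₂ _+_ (length-funs xs m) (constant ys)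

length-allFin : ∀ n → length (allFin n) ≡ n
length-allFin n = length-tabulate (λ i → i)

allFun : ∀ {n m} (f : Fin m → Fin n) → ∃[ g ] (g ∈ funs (allFin n) m × f ≗ g)
allFun {n} {m} f = funs-complete {_~_ = _≡_} (allFin n) m f (λ i → f i , ∈-allFin _ , refl)

injective-resp : ∀ {A : Set} {m} {f g : Fin m → A} → f ≗ g → Injective f → Injective g
injective-resp eq inj x y gx≡gy = inj x y (trans (eq x) (trans gx≡gy (sym (eq y))))

injections : (n m : ℕ) → List (Fin m → Fin n)
injections n m = filter (injective? Fin._≟_) (funs (allFin n) m)

∈-injections⁻ : ∀ {n m f} → f ∈ injections n m → Injective f
∈-injections⁻ {n} {m} f∈ = proj₂ (∈-filter⁻ (injective? Fin._≟_) {xs = funs (allFin n) m} f∈)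

injections-complete : ∀ {n m} (f : Fin m → Fin n) → Injective f → ∃[ g ] (g ∈ injections n m × f ≗ g)
injections-complete f inj =
  let (g , g∈ , eq) = allFun f in g , ∈-filter⁺ _ g∈ (injective-resp eq inj) , eq

injections-distinct : ∀ n m → Distinct _≗_ (injections n m)
injections-distinct n m = AllPairsP.filter⁺ _ (funs-distinct (allFin-distinct n) m)

length-injections-≤ : ∀ n m → length (injections n m) ≤ n ^ m
length-injections-≤ n m = begin
  length (injections n m)     ≤⟨ length-filter _ (funs (allFin n) m) ⟩
  length (funs (allFin n) m)  ≡⟨ length-funs (allFin n) m ⟩
  length (allFin n) ^ m       ≡⟨ cong (_^ m) (length-allFin n) ⟩
  n ^ m                       ∎
  where open ≤-Reasoning

length-injections-step : ∀ n m → (n ∸ m) * length (injections n m) ≤ length (injections n (suc m))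
length-injections-step n m = length-distinct-pairs-≤ (λ f → fresh (tabulate f))
  (λ (f , b) g → g ≗ consF b f)
  (injections-distinct n m) (λ {f} _ → fresh-distinct (tabulate f))
  (λ {f} _ → length-fresh (tabulate f) (length-tabulate f))
  (λ {f} {b} f∈ b∈ → let (g , g∈ , eq) = injections-complete (consF b f) (cons-inj (∈-injections⁻ f∈) (∈-fresh⁻ b∈))
                     in g , g∈ , sym ∘ eq)
  (λ e e′ → (λ i → trans (sym (e (suc i))) (e′ (suc i))) , trans (sym (e zero)) (e′ zero))
  where
  cons-inj : ∀ {b} {f : Fin m → Fin n} → Injective f → b ∉ tabulate f → Injective (consF b f)
  cons-inj inj b∉ zero    zero    _  = refl
  cons-inj inj b∉ zero    (suc j) eq = contradiction (subst (_∈ _) (sym eq) (∈-tabulate⁺ j)) b∉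
  cons-inj inj b∉ (suc i) zero    eq = contradiction (subst (_∈ _) eq (∈-tabulate⁺ i)) b∉
  cons-inj inj b∉ (suc i) (suc j) eq = cong suc (inj i j eq)

-- Each factor of the falling factorial is at least `n ∸ v`. The base stays fixed during the
-- induction, so the result is a plain power to which `power-deficit` applies.
length-injections-≥ : ∀ n {v} m → m ≤ v → (n ∸ v) ^ m ≤ length (injections n m)
length-injections-≥ n zero _ = ≤-refl
length-injections-≥ n {v} (suc m) m<v = begin
  (n ∸ v) * (n ∸ v) ^ m               ≤⟨ *-mono-≤ (∸-monoʳ-≤ n (≤-trans (n≤1+n m) m<v)) (length-injections-≥ n m (≤-trans (n≤1+n m) m<v)) ⟩
  (n ∸ m) * length (injections n m)   ≤⟨ length-injections-step n m ⟩
  length (injections n (suc m))       ∎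
  where open ≤-Reasoning

_≋_ : ∀ {n k} → Tuple n k → Tuple n k → Set
σ ≋ τ = ∀ j i → σ j i ≡ τ j i

tuples-perm : ∀ {n k σ} → σ ∈ allTuples n k → IsPermTuple σ
tuples-perm {n} {k} σ∈ j = ∈-injections⁻ {n} {n} (funs-sound (allPerms n) k σ∈ j)

tuples-complete : ∀ {n k} (σ : Tuple n k) → IsPermTuple σ → ∃[ τ ] (τ ∈ allTuples n k × σ ≋ τ)
tuples-complete {n} {k} σ perm = funs-complete {_~_ = _≗_} (allPerms n) k σ (λ j → injections-complete (σ j) (perm j))

tuples-distinct : ∀ n k → Distinct _≋_ (allTuples n k)
tuples-distinct n k = funs-distinct (injections-distinct n n) k

tuples-nonempty : ∀ n k → 1 ≤ length (allTuples n k)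
tuples-nonempty n k = ∈-length (proj₁ (proj₂ (tuples-complete {n} {k} (λ _ i → i) (λ _ _ _ eq → eq))))

transpose-left : ∀ {n} (a b : Fin n) → transpose a b a ≡ b
transpose-left a b with a Fin.≟ a
... | yes _ = refl
... | no a≢a = contradiction refl a≢a

transpose-other : ∀ {n} {a b x : Fin n} → x ≢ a → x ≢ b → transpose a b x ≡ x
transpose-other {a = a} {b} {x} x≢a x≢b with x Fin.≟ a
... | yes x≡a = contradiction x≡a x≢a
... | no _ with x Fin.≟ b
...   | yes x≡b = contradiction x≡b x≢b
...   | no _ = refl

transpose-injective : ∀ {n} (a b : Fin n) {x y} → transpose a b x ≡ transpose a b y → x ≡ y
transpose-injective a b eq =
  trans (sym (transpose-inverse b a)) (trans (cong (transpose b a) eq) (transpose-inverse b a))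

-- The transposition acts on values: the arguments with values `a` and `b` under `σ l` exchange
-- them, and nothing else changes.
switch : ∀ {n k} → Fin k → Fin n → Fin n → Tuple n k → Tuple n k
switch l a b σ j i with j Fin.≟ l
... | yes _ = transpose a b (σ j i)
... | no _  = σ j i

switch-perm : ∀ {n k} l a b {σ : Tuple n k} → IsPermTuple σ → IsPermTuple (switch l a b σ)
switch-perm l a b perm j x y eq with j Fin.≟ l
... | yes _ = perm j x y (transpose-injective a b eq)
... | no _  = perm j x y eq

switch-injective : ∀ {n k} l a b {σ τ : Tuple n k} → switch l a b σ ≋ switch l a b τ → σ ≋ τ
switch-injective l a b eq j i with j Fin.≟ l | eq j i
... | yes _ | e = transpose-injective a b e
... | no _  | e = e

switch-at : ∀ {n k} l a b (σ : Tuple n k) {i} → σ l i ≡ a → switch l a b σ l i ≡ b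
switch-at l a b σ eq with l Fin.≟ l
... | yes _ = trans (cong (transpose a b) eq) (transpose-left a b)
... | no l≢l = contradiction refl l≢l

switch-other : ∀ {n k} l a b (σ : Tuple n k) {j i} →
  (j ≡ l → σ j i ≢ a) → (j ≡ l → σ j i ≢ b) → switch l a b σ j i ≡ σ j i
switch-other l a b σ {j} ≢a ≢b with j Fin.≟ l
... | yes j≡l = transpose-other (≢a j≡l) (≢b j≡l)
... | no _ = refl

-- Counting tuples with prescribed values

Arc : ℕ → ℕ → Set
Arc k m = Fin k × Fin m × Fin m

label : ∀ {k m} → Arc k m → Fin k
label = proj₁

source target : ∀ {k m} → Arc k m → Fin m
source (_ , s , _) = s
target (_ , _ , t) = t

-- An arc prescribes one value of one permutation. Arcs related by `SameOut` prescribe the value at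
-- the same argument, arcs related by `SameIn` the same value. Distinct arguments make a new
-- prescription independent of the old ones; distinct values keep it compatible with them.
SameOut SameIn : ∀ {k m} → Arc k m → Arc k m → Set
SameOut c c′ = label c ≡ label c′ × source c ≡ source c′
SameIn  c c′ = label c ≡ label c′ × target c ≡ target c′

Follows : ∀ {n k m} → Tuple n k → (Fin m → Fin n) → Arc k m → Set
Follows σ φ c = σ (label c) (φ (source c)) ≡ φ (target c)

follows? : ∀ {n k m} (φ : Fin m → Fin n) (L : List (Arc k m)) (σ : Tuple n k) → Dec (All (Follows σ φ) L)
follows? φ L σ = All.all? (λ c → σ (label c) (φ (source c)) Fin.≟ φ (target c)) L

follows-resp : ∀ {n k m} {σ τ : Tuple n k} {φ : Fin m → Fin n} {L} → σ ≋ τ → All (Follows σ φ) L → All (Follows τ φ) L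
follows-resp eq = All.map (trans (sym (eq _ _)))

module _ {k m : ℕ} (n : ℕ) where

  followers : List (Arc k m) → (Fin m → Fin n) → List (Tuple n k)
  followers L φ = filter (follows? φ L) (allTuples n k)

  solutions : List (Arc k m) → List ((Fin m → Fin n) × Tuple n k)
  solutions L = pairs (followers L) (injections n m)

  _≈ˢ_ : (Fin m → Fin n) × Tuple n k → (Fin m → Fin n) × Tuple n k → Set
  (φ , σ) ≈ˢ (φ′ , σ′) = φ ≗ φ′ × σ ≋ σ′

  followers-distinct : ∀ L φ → Distinct _≋_ (followers L φ)
  followers-distinct L φ = AllPairsP.filter⁺ _ (tuples-distinct n k)

  solutions-distinct : ∀ L → Distinct _≈ˢ_ (solutions L)
  solutions-distinct L = join-distinct _,_ (followers L) (λ eq → eq)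
    (injections-distinct n m) (λ {φ} _ → followers-distinct L φ)

  ∈-solutions⁻ : ∀ L {φ σ} → (φ , σ) ∈ solutions L →
    φ ∈ injections n m × σ ∈ allTuples n k × All (Follows σ φ) L
  ∈-solutions⁻ L φσ∈ with ∈-join⁻ _,_ (followers L) (injections n m) φσ∈
  ... | φ , σ , φ∈ , σ∈ , refl = φ∈ , ∈-filter⁻ (follows? φ L) σ∈

  solutions-complete : ∀ L {φ σ} → φ ∈ injections n m → IsPermTuple σ → All (Follows σ φ) L →
    ∃[ τ ] ((φ , τ) ∈ solutions L × σ ≋ τ)
  solutions-complete L {φ} {σ} φ∈ perm fol =
    let (τ , τ∈ , eq) = tuples-complete σ perm
    in τ , ∈-join⁺ _,_ (followers L) φ∈ (∈-filter⁺ (follows? φ L) τ∈ (follows-resp eq fol)) , eq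

  -- Redirecting the image of the new arc to any of the other free targets
  -- shows that all of them are equally likely.
  length-solutions-extend-≤ : ∀ c L → All (λ c′ → ¬ SameOut c c′) L →
    (n ∸ length L) * length (solutions (c ∷ L)) ≤ length (solutions L)
  length-solutions-extend-≤ c@(l , s , t) L out≢ =
    length-distinct-pairs-≤ (λ (φ , _) → free φ) Redirected
      (solutions-distinct (c ∷ L)) (λ {(φ , _)} _ → fresh-distinct (map (φ ∘ target) L))
      (λ {(φ , _)} _ → length-fresh (map (φ ∘ target) L) (length-map (φ ∘ target) L))
      redirect recover
    where
    free : (Fin m → Fin n) → List (Fin n)
    free φ = fresh (map (φ ∘ target) L)
    -- The last component makes `b` recoverable: since `σ l (φ s)` was `φ t`, the switched value
    -- `τ l (φ s)` is `b`.
    Redirected : ((Fin m → Fin n) × Tuple n k) × Fin n → (Fin m → Fin n) × Tuple n k → Set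
    Redirected ((φ , σ) , b) (φ′ , τ) = φ ≡ φ′ × switch l (φ t) b σ ≋ τ × σ l (φ s) ≡ φ t
    redirect : ∀ {z b} → z ∈ solutions (c ∷ L) → b ∈ free (proj₁ z) →
      ∃[ y ] (y ∈ solutions L × Redirected (z , b) y)
    redirect {φ , σ} {b} z∈ b∈ with ∈-solutions⁻ (c ∷ L) z∈
    ... | φ∈ , σ∈ , (fol-c ∷ fol) =
      let (τ , τ∈ , eq) = solutions-complete L φ∈ (switch-perm l (φ t) b (tuples-perm σ∈)) (All.tabulate kept)
      in (φ , τ) , τ∈ , refl , eq , fol-c
      where
      -- An old arc would be disturbed if its value were `φ t`, but then injectivity of `σ l` and
      -- `φ` would make it start at `s`; or if its value were `b`, which is fresh.
      kept : ∀ {c′} → c′ ∈ L → Follows (switch l (φ t) b σ) φ c′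
      kept {c′} c′∈ = trans (switch-other l (φ t) b σ
        (λ { refl eq → All.lookup out≢ c′∈ (refl ,
               ∈-injections⁻ φ∈ _ _ (tuples-perm σ∈ l _ _ (trans fol-c (sym eq)))) })
        (λ { refl eq → ∈-fresh⁻ b∈ (subst (_∈ _) (trans (sym (All.lookup fol c′∈)) eq) (∈-map⁺ (φ ∘ target) c′∈)) }))
        (All.lookup fol c′∈)
    recover : ∀ {z b z′ b′ y} → Redirected (z , b) y → Redirected (z′ , b′) y → z ≈ˢ z′ × b ≡ b′
    recover {φ , σ} {b} {_ , σ′} {b′} (refl , eq , at) (refl , eq′ , at′) with b≡b′
      where
      b≡b′ : b ≡ b′
      b≡b′ = trans (sym (switch-at l (φ t) b σ at))
        (trans (trans (eq l (φ s)) (sym (eq′ l (φ s)))) (switch-at l (φ t) b′ σ′ at′))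
    ... | refl = ((λ _ → refl) , switch-injective l (φ t) b (λ j i → trans (eq j i) (sym (eq′ j i)))) , refl

  -- The reverse switching: any solution is forced to follow `c` as well, and the overwritten value
  -- `b`, one of `n`, is remembered so that the switch can be undone.
  length-solutions-extend-≥ : ∀ c L → All (λ c′ → ¬ SameOut c c′) L → All (λ c′ → ¬ SameIn c c′) L →
    length (solutions L) ≤ n * length (solutions (c ∷ L))
  length-solutions-extend-≥ c@(l , s , t) L out≢ in≢ = begin
    length (solutions L)                                           ≤⟨ length-≤ Redirected (solutions-distinct L) redirect recover ⟩
    length (cartesianProduct (allFin n) (solutions (c ∷ L)))       ≡⟨ length-cartesianProduct (allFin n) (solutions (c ∷ L)) ⟩
    length (allFin n) * length (solutions (c ∷ L))                 ≡⟨ cong (_* length (solutions (c ∷ L))) (length-allFin n) ⟩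
    n * length (solutions (c ∷ L))                                 ∎
    where
    open ≤-Reasoning
    Redirected : (Fin m → Fin n) × Tuple n k → Fin n × ((Fin m → Fin n) × Tuple n k) → Set
    Redirected (φ , σ) (b , (φ′ , τ)) = φ ≡ φ′ × σ l (φ s) ≡ b × switch l b (φ t) σ ≋ τ
    redirect : ∀ {z} → z ∈ solutions L → ∃[ y ] (y ∈ cartesianProduct (allFin n) (solutions (c ∷ L)) × Redirected z y)
    redirect {φ , σ} z∈ with ∈-solutions⁻ L z∈
    ... | φ∈ , σ∈ , fol =
      let (τ , τ∈ , eq) = solutions-complete (c ∷ L) φ∈ (switch-perm l b (φ t) (tuples-perm σ∈))
                            (switch-at l b (φ t) σ refl ∷ All.tabulate kept)
      in (b , φ , τ) , ∈-cartesianProduct⁺ (∈-allFin b) τ∈ , refl , refl , eq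
      where
      b = σ l (φ s)
      kept : ∀ {c′} → c′ ∈ L → Follows (switch l b (φ t) σ) φ c′
      kept {c′} c′∈ = trans (switch-other l b (φ t) σ
        (λ { refl eq → All.lookup out≢ c′∈ (refl , sym (∈-injections⁻ φ∈ _ _ (tuples-perm σ∈ l _ _ eq))) })
        (λ { refl eq → All.lookup in≢ c′∈ (refl , ∈-injections⁻ φ∈ _ _ (trans (sym eq) (All.lookup fol c′∈))) }))
        (All.lookup fol c′∈)
    recover : ∀ {z z′ y} → Redirected z y → Redirected z′ y → z ≈ˢ z′
    recover {φ , σ} (refl , refl , eq) (refl , _ , eq′) =
      (λ _ → refl) , switch-injective l (σ l (φ s)) (φ t)
        (λ j i → trans (eq j i) (sym (eq′ j i)))

  length-solutions-[] : length (solutions []) ≡ length (injections n m) * length (allTuples n k)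
  length-solutions-[] = trans (length-join _,_ (followers []) (injections n m)) (constant (injections n m))
    where
    constant : ∀ φs → sum (map (length ∘ followers []) φs) ≡ length φs * length (allTuples n k)
    constant [] = refl
    constant (φ ∷ φs) = cong₂ _+_
      (cong length (filter-all (follows? φ []) (All.universal (λ _ → []) (allTuples n k)))) (constant φs)

  -- Each arc gains a factor `n ∸ length L`, weakened to `n ∸ E` so that one base serves the whole
  -- induction.
  length-solutions-≤ : ∀ {E} L → AllPairs (λ c c′ → ¬ SameOut c c′) L → length L ≤ E →
    (n ∸ E) ^ length L * length (solutions L) ≤ n ^ m * length (allTuples n k)
  length-solutions-≤ [] _ _ = begin
    1 * length (solutions [])                            ≡⟨ *-identityˡ _ ⟩
    length (solutions [])                                ≡⟨ length-solutions-[] ⟩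
    length (injections n m) * length (allTuples n k)     ≤⟨ *-monoˡ-≤ _ (length-injections-≤ n m) ⟩
    n ^ m * length (allTuples n k)                       ∎
    where open ≤-Reasoning
  length-solutions-≤ {E} (c ∷ L) (out≢ ∷ outs) L<E = begin
    (n ∸ E) * q * length (solutions (c ∷ L))             ≡⟨ cong (_* length (solutions (c ∷ L))) (*-comm (n ∸ E) q) ⟩
    q * (n ∸ E) * length (solutions (c ∷ L))             ≡⟨ *-assoc q (n ∸ E) _ ⟩
    q * ((n ∸ E) * length (solutions (c ∷ L)))           ≤⟨ *-monoʳ-≤ q (*-monoˡ-≤ _ (∸-monoʳ-≤ n L≤E)) ⟩
    q * ((n ∸ length L) * length (solutions (c ∷ L)))    ≤⟨ *-monoʳ-≤ q (length-solutions-extend-≤ c L out≢) ⟩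
    q * length (solutions L)                             ≤⟨ length-solutions-≤ L outs L≤E ⟩
    n ^ m * length (allTuples n k)                       ∎
    where
    open ≤-Reasoning
    q = (n ∸ E) ^ length L
    L≤E : length L ≤ E
    L≤E = ≤-trans (n≤1+n _) L<E

  length-solutions-≥ : ∀ L → AllPairs (λ c c′ → ¬ SameOut c c′) L → AllPairs (λ c c′ → ¬ SameIn c c′) L →
    (n ∸ m) ^ m * length (allTuples n k) ≤ n ^ length L * length (solutions L)
  length-solutions-≥ [] _ _ = begin
    (n ∸ m) ^ m * length (allTuples n k)                 ≤⟨ *-monoˡ-≤ _ (length-injections-≥ n m ≤-refl) ⟩
    length (injections n m) * length (allTuples n k)     ≡⟨ length-solutions-[] ⟨
    length (solutions [])                                ≡⟨ *-identityˡ _ ⟨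
    1 * length (solutions [])                            ∎
    where open ≤-Reasoning
  length-solutions-≥ (c ∷ L) (out≢ ∷ outs) (in≢ ∷ ins) = begin
    (n ∸ m) ^ m * length (allTuples n k)                 ≤⟨ length-solutions-≥ L outs ins ⟩
    q * length (solutions L)                             ≤⟨ *-monoʳ-≤ q (length-solutions-extend-≥ c L out≢ in≢) ⟩
    q * (n * length (solutions (c ∷ L)))                 ≡⟨ *-assoc q n _ ⟨
    q * n * length (solutions (c ∷ L))                   ≡⟨ cong (_* length (solutions (c ∷ L))) (*-comm q n) ⟩
    n * q * length (solutions (c ∷ L))                   ∎
    where
    open ≤-Reasoning
    q = n ^ length L

-- Pruning

bit : Bool → ℕ
bit b = if b then 1 else 0

bit-∧ : ∀ a b → bit (a ∧ b) ≡ bit a * bit b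
bit-∧ true b = sym (+-identityʳ (bit b))
bit-∧ false _ = refl

countB≡∑ : ∀ {m} (p : Fin m → Bool) → countB p ≡ ∑ (λ i → bit (p i))
countB≡∑ {zero} p = refl
countB≡∑ {suc m} p = cong (bit (p zero) +_) (countB≡∑ (p ∘ suc))

countB-cong : ∀ {m} {p q : Fin m → Bool} → p ≗ q → countB p ≡ countB q
countB-cong {zero} eq = refl
countB-cong {suc m} eq = cong₂ (λ b c → bit b + c) (eq zero) (countB-cong (eq ∘ suc))

∑-mono : ∀ {m} {f g : Fin m → ℕ} → (∀ i → f i ≤ g i) → ∑ f ≤ ∑ g
∑-mono {zero} _ = z≤n
∑-mono {suc m} le = +-mono-≤ (le zero) (∑-mono (le ∘ suc))

∑-zero : ∀ {m} {f : Fin m → ℕ} → (∀ i → f i ≡ 0) → ∑ f ≡ 0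
∑-zero {zero} _ = refl
∑-zero {suc m} eq = cong₂ _+_ (eq zero) (∑-zero (eq ∘ suc))

∑-indicator : ∀ {m} (u : Fin m → ℕ) s → ∑ (λ x → u x * bit ⌊ s Fin.≟ x ⌋) ≡ u s
∑-indicator u zero = trans (cong₂ _+_ (*-identityʳ (u zero)) (∑-zero (λ i → *-zeroʳ (u (suc i))))) (+-identityʳ _)
∑-indicator u (suc s) = trans (cong (_+ ∑ (λ x → u (suc x) * bit ⌊ suc s Fin.≟ suc x ⌋)) (*-zeroʳ (u zero)))
  (trans (sum-cong-≗ (λ x → cong (λ b → u (suc x) * bit b) (isYes-suc s x))) (∑-indicator (u ∘ suc) s))
  where
  isYes-suc : ∀ {m} (s x : Fin m) → ⌊ suc s Fin.≟ suc x ⌋ ≡ ⌊ s Fin.≟ x ⌋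
  isYes-suc s x with s Fin.≟ x
  ... | yes _ = refl
  ... | no _ = refl

⌊⌋-true : {P : Set} (d : Dec P) → P → ⌊ d ⌋ ≡ true
⌊⌋-true (yes _) _ = refl
⌊⌋-true (no ¬p) p = contradiction p ¬p

⌊⌋-sound : {P : Set} (d : Dec P) → ⌊ d ⌋ ≡ true → P
⌊⌋-sound (yes p) _ = p

∧-true⁺ : ∀ {a b} → a ≡ true → b ≡ true → a ∧ b ≡ true
∧-true⁺ refl refl = refl

∧-true⁻ : ∀ {a b} → a ∧ b ≡ true → a ≡ true × b ≡ true
∧-true⁻ {true} {true} _ = refl , refl

≢true⇒≡false : ∀ {b} → b ≢ true → b ≡ false
≢true⇒≡false {true} b≢ = contradiction refl b≢
≢true⇒≡false {false} _ = refl

countB-none : ∀ {m} {p : Fin m → Bool} → (∀ i → p i ≢ true) → countB p ≡ 0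
countB-none {zero} none = refl
countB-none {suc m} {p} none rewrite ≢true⇒≡false (none zero) = countB-none (none ∘ suc)

countB-pos : ∀ {m} {p : Fin m → Bool} {i} → p i ≡ true → 1 ≤ countB p
countB-pos {p = p} {zero} eq rewrite eq = s≤s z≤n
countB-pos {p = p} {suc i} eq = ≤-trans (countB-pos {p = p ∘ suc} {i} eq) (m≤n+m _ (bit (p zero)))

countB-exists : ∀ {m} {p : Fin m → Bool} → 1 ≤ countB p → ∃[ i ] p i ≡ true
countB-exists {suc m} {p} pos with p zero in eq
... | true = zero , eq
... | false = let (i , pi) = countB-exists {p = p ∘ suc} pos in suc i , pi

countB-unique : ∀ {m} {p : Fin m → Bool} {i j} → countB p ≤ 1 → p i ≡ true → p j ≡ true → i ≡ j
countB-unique {i = zero} {zero} _ _ _ = refl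
countB-unique {p = p} {zero} {suc j} le pi pj rewrite pi =
  contradiction (≤-trans (s≤s (countB-pos {p = p ∘ suc} {j} pj)) le) λ { (s≤s ()) }
countB-unique {p = p} {suc i} {zero} le pi pj rewrite pj =
  contradiction (≤-trans (s≤s (countB-pos {p = p ∘ suc} {i} pi)) le) λ { (s≤s ()) }
countB-unique {p = p} {suc i} {suc j} le pi pj =
  cong suc (countB-unique {p = p ∘ suc} (≤-trans (m≤n+m _ (bit (p zero))) le) pi pj)

countB-one : ∀ {m} {p : Fin m → Bool} {i} → p i ≡ true → (∀ j → p j ≡ true → j ≡ i) → countB p ≡ 1
countB-one {p = p} {zero} pi only rewrite pi =
  cong suc (countB-none (λ j pj → contradiction (only (suc j) pj) λ ()))
countB-one {p = p} {suc i} pi only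
  rewrite ≢true⇒≡false {p zero} (λ p0 → contradiction (only zero p0) λ ()) =
  countB-one {p = p ∘ suc} pi (λ j pj → FinP.suc-injective (only (suc j) pj))

iter-preserves : ∀ {A : Set} (P : A → Set) {f : A → A} → (∀ {a} → P a → P (f a)) → ∀ m {a} → P a → P (iter m f a)
iter-preserves P step zero pa = pa
iter-preserves P step (suc m) pa = iter-preserves P step m (step pa)

module Pruning {k : ℕ} (T : LGraph k) where

  -- Half-edges: `inj₁ ε` is the source end and `inj₂ ε` the target end. A loop has two ends at its
  -- vertex, in agreement with its contribution 2 to `degree`.
  End : Set
  End = Fin (nE T) ⊎ Fin (nE T)

  edge : End → Fin (nE T)
  edge = [ (λ ε → ε) , (λ ε → ε) ]

  at : End → Fin (nV T)
  at = [ src T , tgt T ]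

  anyEnd? : {P : End → Set} → Decidable P → Dec (∃ P)
  anyEnd? P? = map′ [ (λ (ε , p) → inj₁ ε , p) , (λ (ε , p) → inj₂ ε , p) ]
    (λ { (inj₁ ε , p) → inj₁ (ε , p) ; (inj₂ ε , p) → inj₂ (ε , p) })
    (any? (P? ∘ inj₁) ⊎-dec any? (P? ∘ inj₂))

  _≟ᴱ_ : (h h′ : End) → Dec (h ≡ h′)
  _≟ᴱ_ = SumP.≡-dec Fin._≟_ Fin._≟_

  -- The edge sets of leafless subgraphs.
  Branching : (Fin (nE T) → Set) → Set
  Branching A = ∀ h → A (edge h) → ∃[ h′ ] (h′ ≢ h × A (edge h′) × at h′ ≡ at h)

  Kept : SubG T → Fin (nE T) → Set
  Kept (_ , KE) ε = KE ε ≡ true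

  Closed : SubG T → Set
  Closed S@(KV , _) = ∀ h → Kept S (edge h) → KV (at h) ≡ true

  degree-one-unique : ∀ S {h h′} → degree T S (at h) ≡ 1 → Kept S (edge h) → Kept S (edge h′) → at h′ ≡ at h → h′ ≡ h
  degree-one-unique S@(KV , KE) {h} {h′} deg kept kept′ same = go h h′ kept kept′ refl same
    where
    x = at h
    out into : Fin (nE T) → Bool
    out ε = KE ε ∧ ⌊ src T ε Fin.≟ x ⌋
    into ε = KE ε ∧ ⌊ tgt T ε Fin.≟ x ⌋
    out⁺ : ∀ {ε} → KE ε ≡ true → src T ε ≡ x → out ε ≡ true
    out⁺ {ε} kε eq = ∧-true⁺ kε (⌊⌋-true (src T ε Fin.≟ x) eq)
    into⁺ : ∀ {ε} → KE ε ≡ true → tgt T ε ≡ x → into ε ≡ true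
    into⁺ {ε} kε eq = ∧-true⁺ kε (⌊⌋-true (tgt T ε Fin.≟ x) eq)
    both : ∀ {ε ε′} → out ε ≡ true → into ε′ ≡ true → ⊥
    both {ε} {ε′} o i = contradiction
      (≤-trans (+-mono-≤ (countB-pos {p = out} {ε} o) (countB-pos {p = into} {ε′} i)) (≤-reflexive deg)) λ { (s≤s ()) }
    go : ∀ h h′ → Kept S (edge h) → Kept S (edge h′) → at h ≡ x → at h′ ≡ x → h′ ≡ h
    go (inj₁ ε) (inj₁ ε′) kε kε′ eq eq′ = cong inj₁
      (countB-unique {p = out} (≤-trans (m≤m+n _ _) (≤-reflexive deg)) (out⁺ kε′ eq′) (out⁺ kε eq))
    go (inj₁ ε) (inj₂ ε′) kε kε′ eq eq′ = ⊥-elim (both (out⁺ kε eq) (into⁺ kε′ eq′))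
    go (inj₂ ε) (inj₁ ε′) kε kε′ eq eq′ = ⊥-elim (both (out⁺ kε′ eq′) (into⁺ kε eq))
    go (inj₂ ε) (inj₂ ε′) kε kε′ eq eq′ = cong inj₂
      (countB-unique {p = into} (≤-trans (m≤n+m _ (countB out)) (≤-reflexive deg)) (into⁺ kε′ eq′) (into⁺ kε eq))

  degree-one : ∀ S h → Kept S (edge h) → (∀ h′ → Kept S (edge h′) → at h′ ≡ at h → h′ ≡ h) → degree T S (at h) ≡ 1
  degree-one S@(KV , KE) h@(inj₁ ε) kε only = cong₂ _+_
    (countB-one (∧-true⁺ kε (⌊⌋-true (src T ε Fin.≟ src T ε) refl))
      (λ ε′ o → let (kε′ , eq) = ∧-true⁻ o in inj₁-injective (only (inj₁ ε′) kε′ (⌊⌋-sound (_ Fin.≟ _) eq))))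
    (countB-none (λ ε′ i → let (kε′ , eq) = ∧-true⁻ i in contradiction (only (inj₂ ε′) kε′ (⌊⌋-sound (_ Fin.≟ _) eq)) λ ()))
  degree-one S@(KV , KE) h@(inj₂ ε) kε only = cong₂ _+_
    (countB-none (λ ε′ o → let (kε′ , eq) = ∧-true⁻ o in contradiction (only (inj₁ ε′) kε′ (⌊⌋-sound (_ Fin.≟ _) eq)) λ ()))
    (countB-one (∧-true⁺ kε (⌊⌋-true (tgt T ε Fin.≟ tgt T ε) refl))
      (λ ε′ i → let (kε′ , eq) = ∧-true⁻ i in inj₂-injective (only (inj₂ ε′) kε′ (⌊⌋-sound (_ Fin.≟ _) eq))))

  isLeaf⇒degree : ∀ S {x} → isLeaf T S x ≡ true → degree T S x ≡ 1
  isLeaf⇒degree S leaf = ⌊⌋-sound (_ Data.Nat.≟ 1) (proj₂ (∧-true⁻ leaf))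

  step : SubG T → SubG T
  step = pruneStep T

  step-closed : ∀ S → Closed S → Closed (step S)
  step-closed S closed (inj₁ ε) kept = let (kε , ¬leaves) = ∧-true⁻ kept in
    ∧-true⁺ (closed (inj₁ ε) kε) (proj₁ (∧-true⁻ ¬leaves))
  step-closed S closed (inj₂ ε) kept = let (kε , ¬leaves) = ∧-true⁻ kept in
    ∧-true⁺ (closed (inj₂ ε) kε) (proj₂ (∧-true⁻ {not (isLeaf T S (src T ε))} ¬leaves))

  -- Each end of an `A`-edge shares its vertex with a second `A`-end, so that vertex has degree at
  -- least two and is no leaf. Hence the core contains every such edge set.
  step-branching : ∀ {A} → Branching A → ∀ {S} → (∀ {ε} → A ε → Kept S ε) → ∀ {ε} → A ε → Kept (step S) ε
  step-branching branch {S} A⊆ {ε} a = ∧-true⁺ (A⊆ a) (∧-true⁺ (notLeaf (inj₁ ε) a) (notLeaf (inj₂ ε) a))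
    where
    notLeaf : ∀ h → _ → not (isLeaf T S (at h)) ≡ true
    notLeaf h a with isLeaf T S (at h) in eq
    ... | false = refl
    ... | true = let (h′ , h′≢h , a′ , same) = branch h a in
      contradiction (degree-one-unique S (isLeaf⇒degree S eq) (A⊆ a) (A⊆ a′) same) h′≢h

  vertices edges leaves : SubG T → ℕ
  vertices (KV , _) = countB KV
  edges (_ , KE) = countB KE
  leaves S = countB (isLeaf T S)

  -- The handshake identity with vertex weights `u`, by exchanging the order of summation.
  ∑-degree : ∀ S u → ∑ (λ x → u x * degree T S x) ≡ ∑ (λ ε → bit (proj₂ S ε) * (u (src T ε) + u (tgt T ε)))
  ∑-degree S@(KV , KE) u = begin
    ∑ (λ x → u x * degree T S x)
      ≡⟨ sum-cong-≗ (λ x → *-distribˡ-+ (u x) (countB (λ ε → KE ε ∧ ⌊ src T ε Fin.≟ x ⌋)) _) ⟩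
    ∑ (λ x → u x * incident (src T) x + u x * incident (tgt T) x)
      ≡⟨ ∑-distrib-+ (λ x → u x * incident (src T) x) (λ x → u x * incident (tgt T) x) ⟩
    ∑ (λ x → u x * incident (src T) x) + ∑ (λ x → u x * incident (tgt T) x)
      ≡⟨ cong₂ _+_ (one-sided (src T)) (one-sided (tgt T)) ⟩
    ∑ (λ ε → bit (KE ε) * u (src T ε)) + ∑ (λ ε → bit (KE ε) * u (tgt T ε))
      ≡⟨ ∑-distrib-+ (λ ε → bit (KE ε) * u (src T ε)) (λ ε → bit (KE ε) * u (tgt T ε)) ⟨
    ∑ (λ ε → bit (KE ε) * u (src T ε) + bit (KE ε) * u (tgt T ε))
      ≡⟨ sum-cong-≗ (λ ε → sym (*-distribˡ-+ (bit (KE ε)) (u (src T ε)) _)) ⟩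
    ∑ (λ ε → bit (KE ε) * (u (src T ε) + u (tgt T ε))) ∎
    where
    open ≡-Reasoning
    incident : (Fin (nE T) → Fin (nV T)) → Fin (nV T) → ℕ
    incident f x = countB (λ ε → KE ε ∧ ⌊ f ε Fin.≟ x ⌋)
    rearrange : ∀ a b c → a * (b * c) ≡ b * (a * c)
    rearrange = solve-∀
    one-sided : ∀ f → ∑ (λ x → u x * incident f x) ≡ ∑ (λ ε → bit (KE ε) * u (f ε))
    one-sided f = begin
      ∑ (λ x → u x * incident f x)
        ≡⟨ sum-cong-≗ (λ x → trans (cong (u x *_) (countB≡∑ (λ ε → KE ε ∧ ⌊ f ε Fin.≟ x ⌋))) (*-distribˡ-sum (u x) (λ ε → bit (KE ε ∧ ⌊ f ε Fin.≟ x ⌋)))) ⟩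
      ∑ (λ x → ∑ (λ ε → u x * bit (KE ε ∧ ⌊ f ε Fin.≟ x ⌋)))
        ≡⟨ ∑-comm (λ x ε → u x * bit (KE ε ∧ ⌊ f ε Fin.≟ x ⌋)) ⟩
      ∑ (λ ε → ∑ (λ x → u x * bit (KE ε ∧ ⌊ f ε Fin.≟ x ⌋)))
        ≡⟨ sum-cong-≗ (λ ε → sum-cong-≗ (λ x → trans (cong (u x *_) (bit-∧ (KE ε) _)) (rearrange (u x) (bit (KE ε)) _))) ⟩
      ∑ (λ ε → ∑ (λ x → bit (KE ε) * (u x * bit ⌊ f ε Fin.≟ x ⌋)))
        ≡⟨ sum-cong-≗ (λ ε → sym (*-distribˡ-sum (bit (KE ε)) (λ x → u x * bit ⌊ f ε Fin.≟ x ⌋))) ⟩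
      ∑ (λ ε → bit (KE ε) * ∑ (λ x → u x * bit ⌊ f ε Fin.≟ x ⌋))
        ≡⟨ sum-cong-≗ (λ ε → cong (bit (KE ε) *_) (∑-indicator u (f ε))) ⟩
      ∑ (λ ε → bit (KE ε) * u (f ε)) ∎

  -- A leaf has degree one, so the handshake identity weighted by the leaf indicator counts each
  -- leaf once.
  leaves-by-edges : ∀ S → leaves S ≡ ∑ (λ ε → bit (proj₂ S ε) * (bit (isLeaf T S (src T ε)) + bit (isLeaf T S (tgt T ε))))
  leaves-by-edges S = trans (countB≡∑ (isLeaf T S))
    (trans (sum-cong-≗ (λ x → sym (leaf-degree x))) (∑-degree S (bit ∘ isLeaf T S)))
    where
    leaf-degree : ∀ x → bit (isLeaf T S x) * degree T S x ≡ bit (isLeaf T S x)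
    leaf-degree x with isLeaf T S x in eq
    ... | false = refl
    ... | true = trans (+-identityʳ _) (isLeaf⇒degree S eq)

  vertices-step : ∀ S → vertices (step S) + leaves S ≡ vertices S
  vertices-step S@(KV , _) = trans (cong₂ _+_ (countB≡∑ (proj₁ (step S))) (countB≡∑ (isLeaf T S)))
    (trans (sym (∑-distrib-+ (λ x → bit (KV x ∧ not (isLeaf T S x))) (bit ∘ isLeaf T S)))
    (trans (sum-cong-≗ (λ x → split (KV x) ⌊ degree T S x Data.Nat.≟ 1 ⌋)) (sym (countB≡∑ KV))))
    where
    split : ∀ a b → bit (a ∧ not (a ∧ b)) + bit (a ∧ b) ≡ bit a
    split true true = refl
    split true false = refl
    split false _ = refl

  -- Every deleted edge has a leaf at one of its ends, and each leaf lies on one edge. With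
  -- `vertices-step` this shows that edges minus vertices never decreases; it increases when an
  -- isolated edge loses both ends in one round.
  edges-step : ∀ S → edges S ≤ leaves S + edges (step S)
  edges-step S@(_ , KE) = begin
    edges S                                      ≡⟨ countB≡∑ KE ⟩
    ∑ (bit ∘ KE)                                 ≤⟨ ∑-mono (λ ε → cover (KE ε) (isLeaf T S (src T ε)) (isLeaf T S (tgt T ε))) ⟩
    ∑ (λ ε → killed ε + bit (proj₂ (step S) ε))  ≡⟨ ∑-distrib-+ killed (bit ∘ proj₂ (step S)) ⟩
    ∑ killed + ∑ (bit ∘ proj₂ (step S))          ≡⟨ cong₂ _+_ (leaves-by-edges S) (countB≡∑ (proj₂ (step S))) ⟨
    leaves S + edges (step S)                    ∎
    where
    open ≤-Reasoning
    killed : Fin (nE T) → ℕ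
    killed ε = bit (KE ε) * (bit (isLeaf T S (src T ε)) + bit (isLeaf T S (tgt T ε)))
    cover : ∀ a b c → bit a ≤ bit a * (bit b + bit c) + bit (a ∧ not b ∧ not c)
    cover false _ _ = z≤n
    cover true true _ = s≤s z≤n
    cover true false true = s≤s z≤n
    cover true false false = s≤s z≤n

  -- At least one cycle rather than exactly one, in the form of an invariant of pruning.
  Unicyclic : SubG T → Set
  Unicyclic S = Closed S × vertices S ≤ edges S × 1 ≤ vertices S

  step-unicyclic : ∀ {S} → Unicyclic S → Unicyclic (step S)
  step-unicyclic {S@(KV , KE)} (closed , v≤e , 1≤v) = step-closed S closed , v′≤e′ , 1≤v′
    where
    open ≤-Reasoning
    v′≤e′ : vertices (step S) ≤ edges (step S)
    v′≤e′ = +-cancelˡ-≤ (leaves S) _ _ (begin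
      leaves S + vertices (step S)  ≡⟨ +-comm (leaves S) _ ⟩
      vertices (step S) + leaves S  ≡⟨ vertices-step S ⟩
      vertices S                    ≤⟨ v≤e ⟩
      edges S                       ≤⟨ edges-step S ⟩
      leaves S + edges (step S)     ∎)
    1≤v′ : 1 ≤ vertices (step S)
    1≤v′ with vertices (step S) in eq
    ... | suc _ = s≤s z≤n
    -- If every vertex were a leaf, each edge would have two leaf ends, so `leaves S` would be twice
    -- `edges S`; but it would also equal `vertices S`, which is at most `edges S`. No edge and
    -- hence no vertex could exist.
    ... | zero = contradiction (≤-trans 1≤v (≤-trans v≤e e≤0)) λ ()
      where
      allLeaves : ∀ h → Kept S (edge h) → isLeaf T S (at h) ≡ true
      allLeaves h kept with isLeaf T S (at h) in leaf
      ... | true = refl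
      ... | false = contradiction (subst (1 ≤_) eq (countB-pos {i = at h} (∧-true⁺ (closed h kept) (cong not leaf)))) λ ()
      doubled : ∀ ε → bit (KE ε) * (bit (isLeaf T S (src T ε)) + bit (isLeaf T S (tgt T ε))) ≡ bit (KE ε) + bit (KE ε)
      doubled ε with KE ε in kε
      ... | false = refl
      ... | true rewrite allLeaves (inj₁ ε) kε | allLeaves (inj₂ ε) kε = refl
      e≤0 : edges S ≤ 0
      e≤0 = +-cancelˡ-≤ (edges S) _ _ (begin
        edges S + edges S                  ≡⟨ cong₂ _+_ (countB≡∑ KE) (countB≡∑ KE) ⟩
        ∑ (bit ∘ KE) + ∑ (bit ∘ KE)        ≡⟨ ∑-distrib-+ (bit ∘ KE) (bit ∘ KE) ⟨
        ∑ (λ ε → bit (KE ε) + bit (KE ε))  ≡⟨ sum-cong-≗ (λ ε → sym (doubled ε)) ⟩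
        _                                  ≡⟨ leaves-by-edges S ⟨
        leaves S                           ≡⟨ cong (_+ leaves S) eq ⟨
        vertices (step S) + leaves S       ≡⟨ vertices-step S ⟩
        vertices S                         ≤⟨ v≤e ⟩
        edges S                            ≡⟨ +-identityʳ _ ⟨
        edges S + 0                        ∎)

  Leafless : SubG T → Set
  Leafless S = ∀ x → isLeaf T S x ≢ true

  step-leafless : ∀ {S} → Leafless S → Leafless (step S)
  step-leafless {S@(KV , KE)} leafless x leaf = leafless x
    (∧-true⁺ (proj₁ (∧-true⁻ (proj₁ (∧-true⁻ leaf)))) (⌊⌋-true (_ Data.Nat.≟ 1) (trans (sym same-degree) (isLeaf⇒degree (step S) leaf))))
    where
    same : ∀ ε → proj₂ (step S) ε ≡ KE ε
    same ε rewrite ≢true⇒≡false (leafless (src T ε)) | ≢true⇒≡false (leafless (tgt T ε)) = BoolP.∧-identityʳ (KE ε)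
    same-degree : degree T (step S) x ≡ degree T S x
    same-degree = cong₂ _+_ (countB-cong (λ ε → cong (_∧ ⌊ src T ε Fin.≟ x ⌋) (same ε)))
                            (countB-cong (λ ε → cong (_∧ ⌊ tgt T ε Fin.≟ x ⌋) (same ε)))

  -- A round that meets a leaf removes a vertex, so the number of rounds keeps pace with the number
  -- of vertices; once a round meets none, nothing changes any more.
  iter-leafless : ∀ m S → vertices S ≤ m → Leafless (iter m step S)
  iter-leafless zero S@(KV , _) v≤0 x leaf =
    contradiction (≤-trans (countB-pos {p = KV} {x} (proj₁ (∧-true⁻ leaf))) v≤0) λ ()
  iter-leafless (suc m) S v≤1+m with vertices (step S) ≤? m
  ... | yes v′≤m = iter-leafless m (step S) v′≤m
  ... | no v′≰m = iter-preserves Leafless (λ {S} → step-leafless {S}) m (step-leafless {S} (λ x leaf →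
    contradiction (≤-trans (+-mono-≤ (≰⇒> v′≰m) (countB-pos {p = isLeaf T S} {x} leaf))
      (≤-trans (≤-reflexive (vertices-step S)) v≤1+m)) (<⇒≱ (m<m+n (suc m) (s≤s z≤n)))))

  everything : SubG T
  everything = (λ _ → true) , (λ _ → true)

  countB-all : ∀ m → countB {m} (λ _ → true) ≡ m
  countB-all zero = refl
  countB-all (suc m) = cong suc (countB-all m)

  core : SubG T
  core = completePruning T

  core-leafless : Leafless core
  core-leafless = iter-leafless (nV T) everything (≤-reflexive (countB-all (nV T)))

  core-closed : Closed core
  core-closed = iter-preserves Closed (λ {S} → step-closed S) (nV T) (λ _ _ → refl)

  core-maximal : ∀ {A} → Branching A → ∀ {ε} → A ε → Kept core ε
  core-maximal {A} branch = iter-preserves (λ S → ∀ {ε} → A ε → Kept S ε) (λ {S} → step-branching branch {S}) (nV T) (λ _ → refl)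

  -- Order at least 0 enters here: a tree would be pruned until no edge is left.
  core-nonempty : 1 ≤ nV T → nV T ≤ nE T → ∃[ ε ] Kept core ε
  core-nonempty 1≤v v≤e =
    let (_ , v≤e′ , 1≤v′) = iter-preserves Unicyclic (λ {S} → step-unicyclic {S}) (nV T)
          ((λ _ _ → refl) , subst₂ _≤_ (sym (countB-all (nV T))) (sym (countB-all (nE T))) v≤e
                          , subst (1 ≤_) (sym (countB-all (nV T))) 1≤v)
    in countB-exists (≤-trans 1≤v′ v≤e′)

  core-branching : Branching (Kept core)
  core-branching h kept with anyEnd? (λ h′ → ¬? (h′ ≟ᴱ h) ×-dec (proj₂ core (edge h′) BoolP.≟ true) ×-dec (at h′ Fin.≟ at h))
  ... | yes companion = companion
  ... | no none = contradiction
    (∧-true⁺ (core-closed h kept) (⌊⌋-true (_ Data.Nat.≟ 1) (degree-one core h kept only))) (core-leafless (at h))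
    where
    only : ∀ h′ → Kept core (edge h′) → at h′ ≡ at h → h′ ≡ h
    only h′ kept′ same with h′ ≟ᴱ h
    ... | yes eq = eq
    ... | no neq = contradiction (h′ , neq , kept′ , same) none

-- Routes to a set of anchors

least : ∀ {P : ℕ → Set} → (∀ m → Dec (P m)) → ∀ b → P b → ∃[ m ] (P m × ∀ j → P j → m ≤ j)
least P? zero p = zero , p , λ _ _ → z≤n
least P? (suc b) p with P? 0
... | yes p₀ = zero , p₀ , λ _ _ → z≤n
... | no ¬p₀ with least (P? ∘ suc) b p
...   | m , pm , min = suc m , pm , λ { zero p₀ → contradiction p₀ ¬p₀ ; (suc j) pj → s≤s (min j pj) }

≤∑ : ∀ {m} (f : Fin m → ℕ) i → f i ≤ ∑ f
≤∑ f zero = m≤m+n (f zero) _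
≤∑ f (suc i) = ≤-trans (≤∑ (f ∘ suc) i) (m≤n+m _ (f zero))

module Routes {k : ℕ} (T : LGraph k) where

  open Pruning T

  flip : End → End
  flip (inj₁ ε) = inj₂ ε
  flip (inj₂ ε) = inj₁ ε

  same-edge : ∀ h h′ → edge h ≡ edge h′ → h′ ≡ h ⊎ h′ ≡ flip h
  same-edge (inj₁ ε) (inj₁ _) refl = inj₁ refl
  same-edge (inj₁ ε) (inj₂ _) refl = inj₂ refl
  same-edge (inj₂ ε) (inj₁ _) refl = inj₂ refl
  same-edge (inj₂ ε) (inj₂ _) refl = inj₁ refl

  flip-flip : ∀ h → flip (flip h) ≡ h
  flip-flip (inj₁ _) = refl
  flip-flip (inj₂ _) = refl

  -- The anchor `x` is fixed and the far vertex is the index, so recursion on a route carries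
  -- information outwards from the anchor.
  data Route (A : Fin (nE T) → Set) (x : Fin (nV T)) : Fin (nV T) → Set where
    stay : Route A x x
    via  : ∀ h → A (edge h) → Route A x (at (flip h)) → Route A x (at h)

  walk⇒route : ∀ {x y} → Walk T x y → Route (λ _ → ⊤) y x
  walk⇒route here = stay
  walk⇒route (fwd ε w) = via (inj₁ ε) tt (walk⇒route w)
  walk⇒route (bwd ε w) = via (inj₂ ε) tt (walk⇒route w)

  module Anchored (connected : Connected T) {O : Fin (nV T) → Set} (O? : Decidable O) {y₀} (oy₀ : O y₀) where

    Near : ℕ → Fin (nV T) → Set
    Near zero    w = O w
    Near (suc m) w = ∃[ h ] (at h ≡ w × Near m (at (flip h)))

    near? : ∀ m → Decidable (Near m)
    near? zero = O?
    near? (suc m) w = anyEnd? (λ h → (at h Fin.≟ w) ×-dec near? m (at (flip h)))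

    near : ∀ {w} → Walk T w y₀ → ∃[ m ] Near m w
    near here = zero , oy₀
    near (fwd ε w) = let (m , n) = near w in suc m , inj₁ ε , refl , n
    near (bwd ε w) = let (m , n) = near w in suc m , inj₂ ε , refl , n

    distance : ∀ w → ∃[ m ] (Near m w × ∀ j → Near j w → m ≤ j)
    distance w = let (b , n) = near (connected w y₀) in least (λ m → near? m w) b n

    rank : Fin (nV T) → ℕ
    rank w = proj₁ (distance w)

    Up : Fin (nV T) → Set
    Up w = ∃[ h ] (at h ≡ w × rank (at (flip h)) < rank w)

    -- Breadth-first search: the first step of a shortest walk to an anchor lowers the rank. The end
    -- chosen here is the one that `Parent` refers to.
    up : ∀ w → O w ⊎ (¬ O w × Up w)
    up w with O? w | distance w
    ... | yes o | _ = inj₁ o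
    ... | no ¬o | zero , o , _ = contradiction o ¬o
    ... | no ¬o | suc m , (h , at≡ , n) , _ = inj₂ (¬o , h , at≡ , s≤s (proj₂ (proj₂ (distance (at (flip h)))) m n))

    Parent : Fin (nV T) → End → Set
    Parent w h = [ (λ _ → ⊥) , (λ (_ , h′ , _) → h ≡ h′) ] (up w)

    parent? : ∀ w h → Dec (Parent w h)
    parent? w h with up w
    ... | inj₁ _ = no λ ()
    ... | inj₂ (_ , h′ , _) = h ≟ᴱ h′

    parent-unique : ∀ {w h h′} → Parent w h → Parent w h′ → h ≡ h′
    parent-unique {w} p p′ with up w
    ... | inj₂ _ = trans p (sym p′)

    parent-props : ∀ {w h} → Parent w h → ¬ O w × at h ≡ w × rank (at (flip h)) < rank w
    parent-props {w} p with up w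
    parent-props refl | inj₂ (¬o , _ , at≡ , lt) = ¬o , at≡ , lt

    ParentEdge : Fin (nE T) → Set
    ParentEdge ε = ∃[ w ] ∃[ h ] (Parent w h × edge h ≡ ε)

    parentEdge? : Decidable ParentEdge
    parentEdge? ε = any? (λ w → anyEnd? (λ h → parent? w h ×-dec (edge h Fin.≟ ε)))

    AnchoredAt : Fin (nE T) → Fin (nV T) → Set
    AnchoredAt ε w = ∃[ y ] (O y × Route (_≢ ε) y w)

    -- Passing from parent to parent lowers the rank until an anchor is met and crosses parent edges
    -- only. The bound `m` on the rank drives the recursion.
    anchored : ∀ {ε} → ¬ ParentEdge ε → ∀ m w → rank w < m → AnchoredAt ε w
    anchored {ε} ¬parent (suc m) w (s≤s r≤m) with up w in eq
    ... | inj₁ o = w , o , stay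
    ... | inj₂ (_ , h , at≡ , lt) =
      let (y , o , route) = anchored ¬parent m (at (flip h)) (≤-trans lt r≤m)
      in y , o , subst (Route _ y) at≡ (via h h≢ε route)
      where
      h≢ε : edge h ≢ ε
      h≢ε e = ¬parent (w , h , subst (λ u → [ (λ _ → ⊥) , (λ (_ , h′ , _) → h ≡ h′) ] u) (sym eq) refl , e)

    module _ {K : Fin (nE T) → Set} (branching : Branching K)
             {New : Fin (nE T) → Set} (new? : Decidable New)
             (new-at : ∀ h → ¬ O (at h) → New (edge h)) where

      -- As `w` has a parent it is no anchor. Branching yields a second kept end at `w`; its edge is
      -- new, so it is a parent edge by assumption. It differs from the parent edge of `w`, or is a
      -- loop, which cannot lower the rank; so it is the parent edge of the vertex at its other end,
      -- whose rank is larger.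
      ascend : (∀ {ε} → New ε → ParentEdge ε) → ∀ {w h} → Parent w h → K (edge h) →
        ∃[ w′ ] ∃[ h′ ] (Parent w′ h′ × K (edge h′) × rank w < rank w′)
      ascend allParents {w} {h} p kh with parent-props p | branching h kh
      ... | ¬o , refl , lt | h₁ , h₁≢h , kh₁ , same
          with allParents (new-at h₁ (λ o → ¬o (subst O same o)))
      ...   | w′ , h′ , p′ , e with same-edge h₁ h′ (sym e)
      ...     | inj₁ refl =
                contradiction (parent-unique (subst (λ w → Parent w h₁) (trans (sym (proj₁ (proj₂ (parent-props p′)))) same) p′) p) h₁≢h
      ...     | inj₂ refl =
                w′ , h′ , p′ , subst K (sym e) kh₁
                , subst (λ w → rank w < rank w′) (trans (cong at (flip-flip h₁)) same) (proj₂ (proj₂ (parent-props p′)))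

      -- No single rank exceeds `∑ rank`, so the ascent must end; `m` is the room that remains.
      bounded : (∀ {ε} → New ε → ParentEdge ε) → ∀ m {w h} → Parent w h → K (edge h) → ∑ rank < rank w + m → ⊥
      bounded allParents zero {w} _ _ lt = <⇒≱ (subst (∑ rank <_) (+-identityʳ _) lt) (≤∑ rank w)
      bounded allParents (suc m) {w} p kh lt =
        let (w′ , _ , p′ , kh′ , w<w′) = ascend allParents p kh
        in bounded allParents m p′ kh′ (≤-trans lt (≤-trans (≤-reflexive (+-suc (rank w) m)) (+-monoˡ-≤ m w<w′)))

      -- The parent edges form a spanning forest rooted at the anchors.  An edge
      -- outside it has both ends anchored without using the edge itself; if all
      -- new edges were in it, climbing away from the anchors along kept edges
      -- would never stop.
      anchored-new-edge : ∀ {ε₀} → K ε₀ → New ε₀ →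
        ∃[ ε ] (New ε × AnchoredAt ε (src T ε) × AnchoredAt ε (tgt T ε))
      anchored-new-edge {ε₀} kε₀ new₀ with any? (λ ε → new? ε ×-dec ¬? (parentEdge? ε))
      ... | yes (ε , new , ¬parent) = ε , new , anchored ¬parent _ _ ≤-refl , anchored ¬parent _ _ ≤-refl
      ... | no none = ⊥-elim (bounded allParents (suc (∑ rank)) p (subst K (sym e) kε₀) (m≤n+m _ _))
        where
        allParents : ∀ {ε} → New ε → ParentEdge ε
        allParents {ε} new with parentEdge? ε
        ... | yes parent = parent
        ... | no ¬parent = contradiction (ε , new , ¬parent) none
        p = proj₁ (proj₂ (proj₂ (allParents new₀)))
        e = proj₂ (proj₂ (proj₂ (allParents new₀)))

-- Occurrences and their equivalence

module Occurrences {k : ℕ} (T : LGraph k) where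

  open Pruning T
  open Routes T

  Emb : ℕ → Set
  Emb n = (Fin (nV T) → Fin n) × (Fin (nE T) → Fin n × Fin k)

  vmap : ∀ {n} → Emb n → Fin (nV T) → Fin n
  vmap = proj₁

  emap : ∀ {n} → Emb n → Fin (nE T) → Fin n × Fin k
  emap = proj₂

  _≈ᴱ_ : ∀ {n} → Emb n → Emb n → Set
  p ≈ᴱ q = vmap p ≗ vmap q × emap p ≗ emap q

  -- A wrapper around `IsOcc`, which would unfold, so that `σ` and `p` can be inferred from a proof.
  record Occ {n : ℕ} (σ : Tuple n k) (p : Emb n) : Set where
    constructor occurs
    field isOcc : IsOcc σ T (vmap p) (emap p)

    vertex-injective : Injective (vmap p)
    vertex-injective = proj₁ isOcc

    edge-injective : Injective (emap p)
    edge-injective = proj₁ (proj₂ isOcc)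

  open Occ

  occs : ∀ {n} → Tuple n k → List (Emb n)
  occs {n} σ = filter (isOcc? σ T) (cartesianProduct (funs (allFin n) (nV T)) (funs (allEdges n k) (nE T)))

  occs-sound : ∀ {n} {σ : Tuple n k} {p} → p ∈ occs σ → vmap p ∈ funs (allFin n) (nV T) × Occ σ p
  occs-sound {n} {σ} p∈ =
    let (p∈′ , occ) = ∈-filter⁻ (isOcc? σ T) {xs = cartesianProduct (funs (allFin n) (nV T)) (funs (allEdges n k) (nE T))} p∈
    in proj₁ (∈-cartesianProduct⁻ (funs (allFin n) (nV T)) _ p∈′) , occurs occ

  occs-distinct : ∀ {n} (σ : Tuple n k) → Distinct _≈ᴱ_ (occs σ)
  occs-distinct {n} σ = AllPairsP.filter⁺ _ (cartesianProduct-distinct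
    (funs-distinct (allFin-distinct n) (nV T))
    (funs-distinct {_~_ = _≡_} (AllPairs.map (λ ≢ eq → ≢ (cong proj₁ eq , cong proj₂ eq))
      (cartesianProduct-distinct (allFin-distinct n) (allFin-distinct k))) (nE T)))

  occ-resp : ∀ {n} {σ τ : Tuple n k} {p q} → σ ≋ τ → p ≈ᴱ q → Occ σ p → Occ τ q
  occ-resp {σ = σ} {τ} σ≋τ (eqφ , eqψ) (occurs (injφ , injψ , hom)) = occurs (
    injective-resp eqφ injφ , injective-resp eqψ injψ , λ ε → let (s , l , t) = hom ε in
      trans (cong proj₁ (sym (eqψ ε))) (trans s (eqφ _)) , trans (cong proj₂ (sym (eqψ ε))) l ,
      trans (sym (σ≋τ _ _)) (trans (cong (λ e → σ (proj₂ e) (proj₁ e)) (sym (eqψ ε))) (trans t (eqφ _))))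

  occs-complete : ∀ {n} {σ : Tuple n k} {p} → Occ σ p → ∃[ q ] (q ∈ occs σ × p ≈ᴱ q)
  occs-complete {n} {p = φ , ψ} occ =
    let (φ′ , φ′∈ , eqφ) = allFun φ
        (ψ′ , ψ′∈ , eqψ) = funs-complete {_~_ = _≡_} (allEdges n k) (nE T) ψ
          (λ ε → ψ ε , ∈-cartesianProduct⁺ (∈-allFin _) (∈-allFin _) , refl)
    in (φ′ , ψ′) , ∈-filter⁺ _ (∈-cartesianProduct⁺ φ′∈ ψ′∈) (isOcc (occ-resp (λ _ _ → refl) (eqφ , eqψ) occ)) , eqφ , eqψ

  module _ {n : ℕ} {σ : Tuple n k} where

    occ-edge : ∀ {p} → Occ σ p → ∀ ε → emap p ε ≡ (vmap p (src T ε) , lab T ε)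
    occ-edge (occurs (_ , _ , hom)) ε = cong₂ _,_ (proj₁ (hom ε)) (proj₁ (proj₂ (hom ε)))

    occ-follows : ∀ {p} → Occ σ p → ∀ ε → σ (lab T ε) (vmap p (src T ε)) ≡ vmap p (tgt T ε)
    occ-follows occ@(occurs (_ , _ , hom)) ε =
      trans (cong (λ e → σ (proj₂ e) (proj₁ e)) (sym (occ-edge occ ε))) (proj₂ (proj₂ (hom ε)))

    occ-end : ∀ {p q} → Occ σ p → Occ σ q → ∀ {ε ε′} → emap p ε ≡ emap q ε′ →
      lab T ε ≡ lab T ε′ × vmap p (src T ε) ≡ vmap q (src T ε′) × vmap p (tgt T ε) ≡ vmap q (tgt T ε′)
    occ-end {p} {q} occ occ′ {ε} {ε′} eq = same-lab , same-src , (begin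
      vmap p (tgt T ε)                     ≡⟨ occ-follows occ ε ⟨
      σ (lab T ε) (vmap p (src T ε))       ≡⟨ cong₂ σ same-lab same-src ⟩
      σ (lab T ε′) (vmap q (src T ε′))     ≡⟨ occ-follows occ′ ε′ ⟩
      vmap q (tgt T ε′)                    ∎)
      where
      open ≡-Reasoning
      same = trans (sym (occ-edge occ ε)) (trans eq (occ-edge occ′ ε′))
      same-lab = cong proj₂ same
      same-src = cong proj₁ same

  emap-determined : ∀ {n} {σ τ : Tuple n k} {p q} → Occ σ p → Occ τ q → vmap p ≗ vmap q → p ≈ᴱ q
  emap-determined occ occ′ eq =
    eq , λ ε → trans (occ-edge occ ε) (trans (cong (_, lab T ε) (eq _)) (sym (occ-edge occ′ ε)))

  -- Applying the permutation goes forward along an edge and its injectivity goes backward. The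
  -- hypotheses concern edges of `A` alone, so the lemma applies to a map that stops following the
  -- tuple at one switched edge.
  propagate : ∀ {n} {σ : Tuple n k} → IsPermTuple σ → ∀ {A : Fin (nE T) → Set} {φ φ′ : Fin (nV T) → Fin n} →
    (∀ {ε} → A ε → σ (lab T ε) (φ (src T ε)) ≡ φ (tgt T ε)) →
    (∀ {ε} → A ε → σ (lab T ε) (φ′ (src T ε)) ≡ φ′ (tgt T ε)) →
    ∀ {x y} → Route A x y → φ x ≡ φ′ x → φ y ≡ φ′ y
  propagate perm f f′ stay eq = eq
  propagate perm f f′ (via (inj₁ ε) a route) eq =
    perm _ _ _ (trans (f a) (trans (propagate perm f f′ route eq) (sym (f′ a))))
  propagate {σ = σ} perm f f′ (via (inj₂ ε) a route) eq =
    trans (sym (f a)) (trans (cong (σ _) (propagate perm f f′ route eq)) (f′ a))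

  occ-determined : Connected T → ∀ {n} {σ : Tuple n k} → IsPermTuple σ → ∀ {p q} → Occ σ p → Occ σ q →
    ∀ {y} → vmap p y ≡ vmap q y → p ≈ᴱ q
  occ-determined connected perm occ occ′ {y} eq = emap-determined occ occ′ (λ x →
    propagate perm (λ {ε} _ → occ-follows occ ε) (λ {ε} _ → occ-follows occ′ ε) (walk⇒route (connected x y)) eq)

  arc : Fin (nE T) → Arc k (nV T)
  arc ε = lab T ε , src T ε , tgt T ε

  arcs : List (Arc k (nV T))
  arcs = tabulate arc

  length-arcs : length arcs ≡ nE T
  length-arcs = length-tabulate arc

  occPairs : ∀ n → List (Tuple n k × Emb n)
  occPairs n = pairs occs (allTuples n k)

  _≈ᴾ_ : ∀ {n} → Tuple n k × Emb n → Tuple n k × Emb n → Set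
  (σ , p) ≈ᴾ (τ , q) = σ ≋ τ × p ≈ᴱ q

  occPairs-distinct : ∀ n → Distinct _≈ᴾ_ (occPairs n)
  occPairs-distinct n = join-distinct _,_ occs (λ eq → eq) (tuples-distinct n k) (λ {σ} _ → occs-distinct σ)

  occPairs-complete : ∀ {n} {σ : Tuple n k} {p} → IsPermTuple σ → Occ σ p → ∃[ z ] (z ∈ occPairs n × (σ , p) ≈ᴾ z)
  occPairs-complete perm occ =
    let (τ , τ∈ , σ≋τ) = tuples-complete _ perm
        (q , q∈ , p≈q) = occs-complete (occ-resp σ≋τ ((λ _ → refl) , (λ _ → refl)) occ)
    in (τ , q) , ∈-join⁺ _,_ occs τ∈ q∈ , σ≋τ , p≈q

  occ-arcs : ∀ {n} {σ : Tuple n k} {p} → Occ σ p → All (Follows σ (vmap p)) arcs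
  occ-arcs occ = AllP.tabulate⁺ (occ-follows occ)

  occPairs≤solutions : ∀ n → length (occPairs n) ≤ length (solutions n arcs)
  occPairs≤solutions n = length-≤ {_≈_ = _≈ᴾ_} R (occPairs-distinct n) total determined
    where
    R : Tuple n k × Emb n → (Fin (nV T) → Fin n) × Tuple n k → Set
    R (σ , p) (φ , τ) = vmap p ≡ φ × σ ≋ τ × Occ σ p
    total : ∀ {z} → z ∈ occPairs n → ∃[ y ] (y ∈ solutions n arcs × R z y)
    total z∈ with ∈-join⁻ _,_ occs (allTuples n k) z∈
    ... | σ , p , σ∈ , p∈ , refl =
      let (φ∈ , occ) = occs-sound {σ = σ} {p} p∈
          (τ , τ∈ , eq) = solutions-complete n arcs (∈-filter⁺ _ φ∈ (vertex-injective occ)) (tuples-perm σ∈) (occ-arcs occ)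
      in (vmap p , τ) , τ∈ , refl , eq , occ
    determined : ∀ {z z′ y} → R z y → R z′ y → z ≈ᴾ z′
    determined (refl , eq , occ) (refl , eq′ , occ′) =
      (λ j i → trans (eq j i) (sym (eq′ j i))) , emap-determined occ occ′ (λ _ → refl)

  module DistinctArcs (out-distinct : ∀ {ε ε′} → SameOut (arc ε) (arc ε′) → ε ≡ ε′) where

    out-pairs : AllPairs (λ c c′ → ¬ SameOut c c′) arcs
    out-pairs = AllPairsP.tabulate⁺ (λ ε≢ε′ same → ε≢ε′ (out-distinct same))

    -- A solution contains no edge map, but `ε` can only go to `(φ (src T ε) , lab T ε)`. This is
    -- injective because no two edges share label and source.
    solutions≤occPairs : ∀ n → length (solutions n arcs) ≤ length (occPairs n)
    solutions≤occPairs n = length-≤ {_≈_ = _≈ˢ_ n} R (solutions-distinct n arcs) total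
      (λ { {_ , _} {_ , _} (eqφ , eqσ) (eqφ′ , eqσ′) →
        (λ x → trans (eqφ x) (sym (eqφ′ x))) , (λ j i → trans (eqσ j i) (sym (eqσ′ j i))) })
      where
      R : (Fin (nV T) → Fin n) × Tuple n k → Tuple n k × Emb n → Set
      R (φ , σ) (τ , q) = φ ≗ vmap q × σ ≋ τ
      total : ∀ {z} → z ∈ solutions n arcs → ∃[ y ] (y ∈ occPairs n × R z y)
      total {φ , σ} z∈ with ∈-solutions⁻ n arcs z∈
      ... | φ∈ , σ∈ , fol =
        let (z , z∈ , σ≋τ , φ≗ , _) = occPairs-complete {p = φ , λ ε → φ (src T ε) , lab T ε} (tuples-perm σ∈)
              (occurs (inj , (λ ε ε′ eq → out-distinct (cong proj₂ eq , inj _ _ (cong proj₁ eq)))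
                           , (λ ε → refl , refl , AllP.tabulate⁻ fol ε)))
        in z , z∈ , φ≗ , σ≋τ
        where inj = ∈-injections⁻ φ∈

  -- Here `p` is the container: the core image of `q` lies in that of `p`.
  Within : ∀ {n} → Emb n → Emb n → Set
  Within p q = ∀ ε → Kept core ε → ∃[ ε′ ] (Kept core ε′ × emap q ε ≡ emap p ε′)

  within? : ∀ {n} (p q : Emb n) → Dec (Within p q)
  within? p q = all? (λ ε → (proj₂ core ε BoolP.≟ true) →-dec
    any? (λ ε′ → (proj₂ core ε′ BoolP.≟ true) ×-dec pair≟ (emap q ε) (emap p ε′)))

  Equiv : ∀ {n} → Emb n → Emb n → Set
  Equiv p q = Within p q × Within q p

  equiv? : ∀ {n} (p q : Emb n) → Dec (Equiv p q)
  equiv? p q = within? p q ×-dec within? q p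

  equiv-sym : ∀ {n} (p q : Emb n) → Equiv p q → Equiv q p
  equiv-sym p q (w , w′) = w′ , w

  within-trans : ∀ {n} (p q r : Emb n) → Within p q → Within q r → Within p r
  within-trans p q r pq qr ε kε =
    let (ε′ , kε′ , eq) = qr ε kε
        (ε″ , kε″ , eq′) = pq ε′ kε′
    in ε″ , kε″ , trans eq eq′

  equiv-trans : ∀ {n} (p q r : Emb n) → Equiv p q → Equiv q r → Equiv p r
  equiv-trans p q r (pq , qp) (qr , rq) = within-trans p q r pq qr , within-trans r q p rq qp

  isAut-resp : ∀ {S α α′ β β′} → α ≗ α′ → β ≗ β′ → IsAut T S α β → IsAut T S α′ β′
  isAut-resp {KV , KE} {α} {α′} {β} {β′} eqα eqβ (fixV , fixE , keepV , keepE , injα , injβ , hom) =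
    (λ x off → trans (sym (eqα x)) (fixV x off)) , (λ ε off → trans (sym (eqβ ε)) (fixE ε off)) ,
    (λ x on → subst (λ y → KV y ≡ true) (eqα x) (keepV x on)) , (λ ε on → subst (λ y → KE y ≡ true) (eqβ ε) (keepE ε on)) ,
    injective-resp eqα injα , injective-resp eqβ injβ ,
    λ ε on → let (s , t , l) = hom ε on in
      trans (cong (src T) (sym (eqβ ε))) (trans s (eqα _)) ,
      trans (cong (tgt T) (sym (eqβ ε))) (trans t (eqα _)) ,
      trans (cong (lab T) (sym (eqβ ε))) l

  automorphisms : List ((Fin (nV T) → Fin (nV T)) × (Fin (nE T) → Fin (nE T)))
  automorphisms = filter (isAut? T core)
    (cartesianProduct (funs (allFin (nV T)) (nV T)) (funs (allFin (nE T)) (nE T)))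

  automorphisms-complete : ∀ {α β} → IsAut T core α β →
    ∃[ α′ ] ∃[ β′ ] ((α′ , β′) ∈ automorphisms × α ≗ α′ × β ≗ β′)
  automorphisms-complete {α} {β} aut =
    let (α′ , α′∈ , eqα) = allFun α
        (β′ , β′∈ , eqβ) = allFun β
    in α′ , β′ , ∈-filter⁺ _ (∈-cartesianProduct⁺ α′∈ β′∈) (isAut-resp eqα eqβ aut) , eqα , eqβ

  automorphisms-nonempty : 1 ≤ pruningAutCount T
  automorphisms-nonempty = ∈-length (proj₁ (proj₂ (proj₂ (automorphisms-complete {λ x → x} {λ ε → ε}
    ((λ _ _ → refl) , (λ _ _ → refl) , (λ _ on → on) , (λ _ on → on) ,
     (λ _ _ eq → eq) , (λ _ _ eq → eq) , (λ _ _ → refl , refl , refl))))))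

  mapEnd : (Fin (nE T) → Fin (nE T)) → End → End
  mapEnd f = [ inj₁ ∘ f , inj₂ ∘ f ]

  edge-mapEnd : ∀ f h → edge (mapEnd f h) ≡ f (edge h)
  edge-mapEnd f (inj₁ _) = refl
  edge-mapEnd f (inj₂ _) = refl

  -- The automorphism φ⁻¹ ∘ φ′ of the core, for occurrences φ and φ′ with the
  -- same core image.
  module Transfer {n : ℕ} {σ : Tuple n k} {p q : Emb n} (occ : Occ σ p) (occ′ : Occ σ q) (within : Within p q) where

    β : Fin (nE T) → Fin (nE T)
    β ε with proj₂ core ε BoolP.≟ true
    ... | yes kε = proj₁ (within ε kε)
    ... | no _ = ε

    β-kept : ∀ {ε} → Kept core ε → Kept core (β ε) × emap q ε ≡ emap p (β ε)
    β-kept {ε} kε with proj₂ core ε BoolP.≟ true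
    ... | yes kε′ = proj₂ (within ε kε′)
    ... | no ¬kε = contradiction kε ¬kε

    β-off : ∀ {ε} → ¬ Kept core ε → β ε ≡ ε
    β-off {ε} ¬kε with proj₂ core ε BoolP.≟ true
    ... | yes kε = contradiction kε ¬kε
    ... | no _ = refl

    β-end : ∀ h → Kept core (edge h) → vmap p (at (mapEnd β h)) ≡ vmap q (at h)
    β-end (inj₁ ε) kε = sym (proj₁ (proj₂ (occ-end occ′ occ (proj₂ (β-kept kε)))))
    β-end (inj₂ ε) kε = sym (proj₂ (proj₂ (occ-end occ′ occ (proj₂ (β-kept kε)))))

    -- The vertex map `α` is read off from the edge map `β` at an end of a core edge; vertices
    -- without such an end are fixed.
    Touched : Fin (nV T) → Set
    Touched x = ∃[ h ] (Kept core (edge h) × at h ≡ x)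

    touched? : ∀ x → Dec (Touched x)
    touched? x = anyEnd? (λ h → (proj₂ core (edge h) BoolP.≟ true) ×-dec (at h Fin.≟ x))

    α : Fin (nV T) → Fin (nV T)
    α x with touched? x
    ... | yes (h , _) = at (mapEnd β h)
    ... | no _ = x

    α-touched : ∀ {x} → Touched x → Touched (α x) × vmap p (α x) ≡ vmap q x
    α-touched {x} touched with touched? x
    ... | yes (h , kh , refl) =
      (mapEnd β h , subst (Kept core) (sym (edge-mapEnd β h)) (proj₁ (β-kept kh)) , refl) , β-end h kh
    ... | no ¬touched = contradiction touched ¬touched

    α-off : ∀ {x} → ¬ Touched x → α x ≡ x
    α-off {x} ¬touched with touched? x
    ... | yes touched = contradiction touched ¬touched
    ... | no _ = refl

    touched-kept : ∀ {x} → Touched x → proj₁ core x ≡ true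
    touched-kept (h , kh , refl) = core-closed h kh

    -- The definition of `α` picks one core end at each touched vertex; injectivity of `vmap p`
    -- makes the result independent of the choice.
    α-end : ∀ h → Kept core (edge h) → at (mapEnd β h) ≡ α (at h)
    α-end h kh = vertex-injective occ _ _ (trans (β-end h kh) (sym (proj₂ (α-touched (h , kh , refl)))))

    isAut : IsAut T core α β
    isAut = (λ x off → α-off (λ touched → contradiction (trans (sym off) (touched-kept touched)) λ ())) ,
      (λ ε off → β-off (λ kε → contradiction (trans (sym off) kε) λ ())) ,
      keepV , (λ ε kε → proj₁ (β-kept kε)) , α-inj , β-inj ,
      (λ ε kε → α-end (inj₁ ε) kε , α-end (inj₂ ε) kε , sym (proj₁ (occ-end occ′ occ (proj₂ (β-kept kε)))))
      where
      keepV : ∀ x → proj₁ core x ≡ true → proj₁ core (α x) ≡ true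
      keepV x on with touched? x
      ... | yes (h , kh , _) = core-closed (mapEnd β h) (subst (Kept core) (sym (edge-mapEnd β h)) (proj₁ (β-kept kh)))
      ... | no _ = on
      α-inj : Injective α
      α-inj x y eq with touched? x | touched? y
      α-inj x y eq | yes tx | yes ty = vertex-injective occ′ _ _
        (trans (sym (proj₂ (α-touched tx))) (trans (cong (vmap p) (trans (α-eq tx) (trans eq (sym (α-eq ty))))) (proj₂ (α-touched ty))))
        where
        α-eq : ∀ {x} (tx : Touched x) → α x ≡ at (mapEnd β (proj₁ tx))
        α-eq (h , kh , refl) = sym (α-end h kh)
      α-inj x y eq | yes (h , kh , refl) | no ¬ty = contradiction
        (subst Touched eq (mapEnd β h , subst (Kept core) (sym (edge-mapEnd β h)) (proj₁ (β-kept kh)) , refl)) ¬ty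
      α-inj x y eq | no ¬tx | yes (h , kh , refl) = contradiction
        (subst Touched (sym eq) (mapEnd β h , subst (Kept core) (sym (edge-mapEnd β h)) (proj₁ (β-kept kh)) , refl)) ¬tx
      α-inj x y eq | no _ | no _ = eq
      β-inj : Injective β
      β-inj ε ε′ eq with proj₂ core ε BoolP.≟ true | proj₂ core ε′ BoolP.≟ true
      ... | yes kε | yes kε′ = edge-injective occ′ _ _
        (trans (proj₂ (proj₂ (within ε kε))) (trans (cong (emap p) eq) (sym (proj₂ (proj₂ (within ε′ kε′))))))
      ... | yes kε | no ¬kε′ = contradiction (subst (Kept core) eq (proj₁ (proj₂ (within ε kε)))) ¬kε′
      ... | no ¬kε | yes kε′ = contradiction (subst (Kept core) (sym eq) (proj₁ (proj₂ (within ε′ kε′)))) ¬kε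
      ... | no _ | no _ = eq

  -- The edge part `β` of the automorphism determines `q`: it fixes the image of a core edge, hence
  -- of a vertex, and connectedness does the rest.
  length-class-≤ : Connected T → nV T ≤ nE T → ∀ {n} {σ : Tuple n k} → IsPermTuple σ → ∀ {p} → p ∈ occs σ →
    length (filter (equiv? p) (occs σ)) ≤ pruningAutCount T
  length-class-≤ connected v≤e {n} {σ} perm {p} p∈ =
    length-≤ {_≈_ = _≈ᴱ_} R (AllPairsP.filter⁺ _ (occs-distinct σ)) total (λ {_} {_} {y} → determined {y = y})
    where
    R : Emb n → (Fin (nV T) → Fin (nV T)) × (Fin (nE T) → Fin (nE T)) → Set
    R q (_ , β) = Occ σ q × (∀ {ε} → Kept core ε → emap q ε ≡ emap p (β ε))
    total : ∀ {q} → q ∈ filter (equiv? p) (occs σ) → ∃[ y ] (y ∈ automorphisms × R q y)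
    total q∈ with ∈-filter⁻ (equiv? p) {xs = occs σ} q∈
    ... | q∈occs , (within , _) =
      let occ = proj₂ (occs-sound {σ = σ} p∈)
          occ′ = proj₂ (occs-sound {σ = σ} q∈occs)
          open Transfer occ occ′ within
          (α′ , β′ , aut∈ , _ , eqβ) = automorphisms-complete isAut
      in (α′ , β′) , aut∈ , occ′ , λ {ε} kε → trans (proj₂ (β-kept kε)) (cong (emap p) (eqβ ε))
    determined : ∀ {q q′ y} → R q y → R q′ y → q ≈ᴱ q′
    determined (occ , eq) (occ′ , eq′) = emap-determined occ occ′ (λ x →
      -- The vertex `x` at which agreement is to be shown itself witnesses that `T` has a vertex.
      let (ε , kε) = core-nonempty (≤-trans {1} (s≤s z≤n) (FinP.toℕ<n x)) v≤e
          same = proj₁ (proj₂ (occ-end occ occ′ {ε} {ε} (trans (eq kε) (sym (eq′ kε)))))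
      in proj₁ (occ-determined connected perm occ occ′ same) x)

-- Pairs of occurrences

module OccurrencePairs {k : ℕ} (T : LGraph k) where

  open Pruning T
  open Routes T
  open Occurrences T
  open Occ

  occurrence : ∀ {n} {σ : Tuple n k} {p : Emb n} → Injective (vmap p) → Injective (emap p) →
    (∀ ε → emap p ε ≡ (vmap p (src T ε) , lab T ε)) →
    (∀ ε → σ (lab T ε) (vmap p (src T ε)) ≡ vmap p (tgt T ε)) → Occ σ p
  occurrence {σ = σ} injφ injψ edge-eq fol = occurs (injφ , injψ , λ ε →
    cong proj₁ (edge-eq ε) , cong proj₂ (edge-eq ε) ,
    trans (cong (λ e → σ (proj₂ e) (proj₁ e)) (edge-eq ε)) (fol ε))

  Meet : ∀ {n} → Emb n → Emb n → Fin (nV T) → Set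
  Meet p q y = ∃[ x ] vmap q y ≡ vmap p x

  meet? : ∀ {n} (p q : Emb n) → Decidable (Meet p q)
  meet? p q y = any? (λ x → vmap q y Fin.≟ vmap p x)

  New : ∀ {n} → Emb n → Emb n → Fin (nE T) → Set
  New p q ε = ∀ ε′ → emap q ε ≢ emap p ε′

  new? : ∀ {n} (p q : Emb n) → Decidable (New p q)
  new? p q ε = all? (λ ε′ → ¬? (pair≟ (emap q ε) (emap p ε′)))

  -- Asymmetric on purpose: the core of `q` leaves that of `p`, and it is `q` that gets switched.
  Straddling : ∀ {n} → Emb n → Emb n → Set
  Straddling p q = ∃ (Meet p q) × ¬ Within p q

  straddling? : ∀ {n} (p q : Emb n) → Dec (Straddling p q)
  straddling? p q = any? (meet? p q) ×-dec ¬? (within? p q)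

  module _ {n : ℕ} where

    pairsWith : {P : Emb n → Emb n → Set} → (∀ p q → Dec (P p q)) → Tuple n k → List (Emb n × Emb n)
    pairsWith P? σ = pairs (λ p → filter (P? p) (occs σ)) (occs σ)

    tuplePairsWith : {P : Emb n → Emb n → Set} → (∀ p q → Dec (P p q)) → List (Tuple n k × (Emb n × Emb n))
    tuplePairsWith P? = pairs (pairsWith P?) (allTuples n k)

    _≈²_ : Emb n × Emb n → Emb n × Emb n → Set
    (p , q) ≈² (p′ , q′) = p ≈ᴱ p′ × q ≈ᴱ q′

    _≈³_ : Tuple n k × (Emb n × Emb n) → Tuple n k × (Emb n × Emb n) → Set
    (σ , pq) ≈³ (σ′ , pq′) = σ ≋ σ′ × pq ≈² pq′

    module _ {P : Emb n → Emb n → Set} (P? : ∀ p q → Dec (P p q)) where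

      ∈-tuplePairs⁻ : ∀ {z} → z ∈ tuplePairsWith P? → ∃[ σ ] ∃[ p ] ∃[ q ]
        (z ≡ (σ , (p , q)) × σ ∈ allTuples n k × p ∈ occs σ × q ∈ occs σ × P p q)
      ∈-tuplePairs⁻ z∈ with ∈-join⁻ _,_ (pairsWith P?) (allTuples n k) z∈
      ... | σ , pq , σ∈ , pq∈ , refl with ∈-join⁻ _,_ (λ p → filter (P? p) (occs σ)) (occs σ) pq∈
      ...   | p , q , p∈ , q∈ , refl =
        let (q∈′ , r) = ∈-filter⁻ (P? p) {xs = occs σ} q∈ in σ , p , q , refl , σ∈ , p∈ , q∈′ , r

      ∈-tuplePairs⁺ : ∀ {σ p q} → σ ∈ allTuples n k → p ∈ occs σ → q ∈ occs σ → P p q → (σ , (p , q)) ∈ tuplePairsWith P?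
      ∈-tuplePairs⁺ {σ} {p} σ∈ p∈ q∈ r = ∈-join⁺ _,_ (pairsWith P?) σ∈
        (∈-join⁺ _,_ (λ p → filter (P? p) (occs σ)) p∈ (∈-filter⁺ (P? p) q∈ r))

      tuplePairs-distinct : Distinct _≈³_ (tuplePairsWith P?)
      tuplePairs-distinct = join-distinct _,_ (pairsWith P?) (λ eq → eq) (tuples-distinct n k)
        (λ {σ} _ → join-distinct _,_ (λ p → filter (P? p) (occs σ)) (λ eq → eq) (occs-distinct σ)
          (λ {p} _ → AllPairsP.filter⁺ (P? p) (occs-distinct σ)))

  shift : ∀ {m m′} → (Fin m → Fin m′) → Arc k m → Arc k m′
  shift f (l , s , t) = l , f s , f t

  leftV rightV : Fin (nV T) → Fin (nV T + nV T)
  leftV x = x ↑ˡ nV T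
  rightV x = nV T ↑ʳ x

  -- Two disjoint copies of `T`. As arcs carry no edge identities, the counts for one copy apply
  -- unchanged.
  doubleArcs : List (Arc k (nV T + nV T))
  doubleArcs = map (shift leftV) arcs ++ map (shift rightV) arcs

  length-doubleArcs : length doubleArcs ≡ nE T + nE T
  length-doubleArcs = trans (length-++ (map (shift leftV) arcs))
    (cong₂ _+_ (trans (length-map (shift leftV) arcs) length-arcs) (trans (length-map (shift rightV) arcs) length-arcs))

  left≢right : ∀ {x y} → leftV x ≢ rightV y
  left≢right {x} {y} eq = contradiction
    (trans (sym (FinP.splitAt-↑ˡ (nV T) x (nV T))) (trans (cong (splitAt (nV T)) eq) (FinP.splitAt-↑ʳ (nV T) (nV T) y))) λ ()

  both : ∀ {n} → Emb n → Emb n → Fin (nV T + nV T) → Fin n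
  both p q z = [ vmap p , vmap q ] (splitAt (nV T) z)

  module _ {n : ℕ} (p q : Emb n) where

    both-left : ∀ x → both p q (leftV x) ≡ vmap p x
    both-left x = cong [ vmap p , vmap q ] (FinP.splitAt-↑ˡ (nV T) x (nV T))

    both-right : ∀ x → both p q (rightV x) ≡ vmap q x
    both-right x = cong [ vmap p , vmap q ] (FinP.splitAt-↑ʳ (nV T) (nV T) x)

    both-injective : Injective (vmap p) → Injective (vmap q) → ¬ ∃ (Meet p q) → Injective (both p q)
    both-injective injp injq disjoint z z′ eq
      with splitAt (nV T) z in ez | splitAt (nV T) z′ in ez′
    ... | inj₁ x | inj₁ x′ = trans (sym (FinP.splitAt⁻¹-↑ˡ ez)) (trans (cong leftV (injp x x′ eq)) (FinP.splitAt⁻¹-↑ˡ ez′))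
    ... | inj₁ x | inj₂ y′ = contradiction (y′ , x , sym eq) disjoint
    ... | inj₂ y | inj₁ x′ = contradiction (y , x′ , eq) disjoint
    ... | inj₂ y | inj₂ y′ = trans (sym (FinP.splitAt⁻¹-↑ʳ ez)) (trans (cong rightV (injq y y′ eq)) (FinP.splitAt⁻¹-↑ʳ ez′))

  both-follows : ∀ {n} {σ : Tuple n k} {p q} {Φ : Fin (nV T + nV T) → Fin n} → both p q ≗ Φ →
    Occ σ p → Occ σ q → All (Follows σ Φ) doubleArcs
  both-follows {σ = σ} {p} {q} eq occ occ′ = AllP.++⁺
    (AllP.map⁺ (AllP.tabulate⁺ (λ ε → follow (λ x → trans (sym (both-left p q x)) (eq _)) (occ-follows occ ε))))
    (AllP.map⁺ (AllP.tabulate⁺ (λ ε → follow (λ x → trans (sym (both-right p q x)) (eq _)) (occ-follows occ′ ε))))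
    where
    follow : ∀ {φ φ′ : Fin (nV T) → Fin _} → φ ≗ φ′ → ∀ {l s t} → σ l (φ s) ≡ φ t → σ l (φ′ s) ≡ φ′ t
    follow eq {l} fol = trans (cong (σ l) (sym (eq _))) (trans fol (eq _))

  doubleArcs-distinct : AllPairs (λ c c′ → ¬ SameOut c c′) arcs → AllPairs (λ c c′ → ¬ SameOut c c′) doubleArcs
  doubleArcs-distinct out-pairs = AllPairsP.++⁺
    (AllPairsP.map⁺ (AllPairs.map (λ ≢ (l , s) → ≢ (l , FinP.↑ˡ-injective (nV T) _ _ s)) out-pairs))
    (AllPairsP.map⁺ (AllPairs.map (λ ≢ (l , s) → ≢ (l , FinP.↑ʳ-injective (nV T) _ _ s)) out-pairs))
    (AllP.map⁺ (All.universal (λ _ → AllP.map⁺ (All.universal (λ _ (_ , s) → left≢right s) arcs)) arcs))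

  nonequivalent? : ∀ {n} (p q : Emb n) → Dec (¬ Equiv p q)
  nonequivalent? p q = ¬? (equiv? p q)

  -- Disjoint pairs solve the system of two copies. A meeting nonequivalent pair is straddling in
  -- one of its two orders, and a `Bool` records which; hence the factor 2.
  length-nonequivalent-≤ : ∀ n → length (tuplePairsWith {n} nonequivalent?) ≤
    length (solutions n doubleArcs) + 2 * length (tuplePairsWith {n} straddling?)
  length-nonequivalent-≤ n = begin
    length (tuplePairsWith nonequivalent?)   ≤⟨ length-≤ {_≈_ = _≈³_} R (tuplePairs-distinct nonequivalent?) total (λ {_} {_} {y} → determined {y = y}) ⟩
    length (map inj₁ sols ++ map inj₂ (cartesianProduct sides straddlers))
      ≡⟨ length-++ (map inj₁ sols) ⟩
    length (map inj₁ sols) + length (map inj₂ (cartesianProduct sides straddlers))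
      ≡⟨ cong₂ _+_ (length-map inj₁ sols) (trans (length-map inj₂ (cartesianProduct sides straddlers)) (length-cartesianProduct sides straddlers)) ⟩
    length sols + 2 * length straddlers      ∎
    where
    open ≤-Reasoning
    sols : List ((Fin (nV T + nV T) → Fin n) × Tuple n k)
    sols = solutions n doubleArcs
    straddlers : List (Tuple n k × (Emb n × Emb n))
    straddlers = tuplePairsWith straddling?
    sides : List Bool
    sides = true ∷ false ∷ []
    Target : Set
    Target = ((Fin (nV T + nV T) → Fin n) × Tuple n k) ⊎ (Bool × (Tuple n k × (Emb n × Emb n)))
    R : Tuple n k × (Emb n × Emb n) → Target → Set
    R (σ , (p , q)) (inj₁ (Φ , τ)) = σ ≋ τ × both p q ≗ Φ × Occ σ p × Occ σ q
    R (σ , (p , q)) (inj₂ (true , z)) = (σ , (p , q)) ≡ z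
    R (σ , (p , q)) (inj₂ (false , z)) = (σ , (q , p)) ≡ z
    total : ∀ {z} → z ∈ tuplePairsWith nonequivalent? →
      ∃[ y ] (y ∈ map inj₁ sols ++ map inj₂ (cartesianProduct sides straddlers) × R z y)
    total z∈ with ∈-tuplePairs⁻ nonequivalent? z∈
    ... | σ , p , q , refl , σ∈ , p∈ , q∈ , ¬equiv with any? (meet? p q)
    ...   | no disjoint =
      let occ = proj₂ (occs-sound {σ = σ} {p} p∈)
          occ′ = proj₂ (occs-sound {σ = σ} {q} q∈)
          (Φ , Φ∈ , eq) = injections-complete (both p q) (both-injective p q (vertex-injective occ) (vertex-injective occ′) disjoint)
          (τ , τ∈ , σ≋τ) = solutions-complete n doubleArcs Φ∈ (tuples-perm σ∈) (both-follows {p = p} {q} eq occ occ′)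
      in inj₁ (Φ , τ) , ∈-++⁺ˡ (∈-map⁺ inj₁ τ∈) , σ≋τ , eq , occ , occ′
    ...   | yes (y , x , meet) with within? p q
    ...     | no ¬within = inj₂ (true , σ , p , q) ,
      ∈-++⁺ʳ (map inj₁ sols) (∈-map⁺ inj₂ (∈-cartesianProduct⁺ {x = true} {xs = sides} (here refl)
        (∈-tuplePairs⁺ straddling? σ∈ p∈ q∈ ((y , x , meet) , ¬within)))) , refl
    ...     | yes within = inj₂ (false , σ , q , p) ,
      ∈-++⁺ʳ (map inj₁ sols) (∈-map⁺ inj₂ (∈-cartesianProduct⁺ {x = false} {xs = sides} (there (here refl))
        (∈-tuplePairs⁺ straddling? σ∈ q∈ p∈ ((x , y , sym meet) , λ within′ → ¬equiv (within , within′))))) , refl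
    determined : ∀ {z z′ y} → R z y → R z′ y → z ≈³ z′
    determined {σ , (p , q)} {σ′ , (p′ , q′)} {inj₁ (Φ , τ)} (eqσ , eqΦ , occp , occq) (eqσ′ , eqΦ′ , occp′ , occq′) =
      (λ j i → trans (eqσ j i) (sym (eqσ′ j i))) ,
      emap-determined occp occp′ (λ x → trans (sym (both-left p q x)) (trans (same _) (both-left p′ q′ x))) ,
      emap-determined occq occq′ (λ x → trans (sym (both-right p q x)) (trans (same _) (both-right p′ q′ x)))
      where
      same : both p q ≗ both p′ q′
      same z = trans (eqΦ z) (sym (eqΦ′ z))
    determined {y = inj₂ (true , _)} refl refl = (λ _ _ → refl) , ((λ _ → refl) , (λ _ → refl)) , ((λ _ → refl) , (λ _ → refl))
    determined {y = inj₂ (false , _)} refl refl = (λ _ _ → refl) , ((λ _ → refl) , (λ _ → refl)) , ((λ _ → refl) , (λ _ → refl))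

  module _ {n : ℕ} {σ : Tuple n k} {p q : Emb n} (occ : Occ σ p) (occ′ : Occ σ q) where

    -- If every core edge of q were an edge of p, these edges would form a
    -- leafless subgraph of p and hence lie in the core of p.
    new-kept-edge : ¬ Within p q → ∃[ ε ] (Kept core ε × New p q ε)
    new-kept-edge ¬within with any? (λ ε → (proj₂ core ε BoolP.≟ true) ×-dec new? p q ε)
    ... | yes found = found
    ... | no none = contradiction within ¬within
      where
      Image : Fin (nE T) → Set
      Image ε′ = ∃[ ε ] (Kept core ε × emap q ε ≡ emap p ε′)
      old : ∀ ε → Kept core ε → ∃[ ε′ ] emap q ε ≡ emap p ε′
      old ε kε with any? (λ ε′ → pair≟ (emap q ε) (emap p ε′))
      ... | yes found = found
      ... | no absent = contradiction (ε , kε , λ ε′ eq → absent (ε′ , eq)) none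
      moved : ∀ h {ε′} → emap q (edge h) ≡ emap p ε′ → vmap q (at h) ≡ vmap p (at (mapEnd (λ _ → ε′) h))
      moved (inj₁ ε) eq = proj₁ (proj₂ (occ-end occ′ occ eq))
      moved (inj₂ ε) eq = proj₂ (proj₂ (occ-end occ′ occ eq))
      lift : ∀ h′ {ε} → emap q ε ≡ emap p (edge h′) → ∃[ h ] (edge h ≡ ε × mapEnd (λ _ → edge h′) h ≡ h′ × vmap q (at h) ≡ vmap p (at h′))
      lift (inj₁ ε′) {ε} eq = inj₁ ε , refl , refl , moved (inj₁ ε) eq
      lift (inj₂ ε′) {ε} eq = inj₂ ε , refl , refl , moved (inj₂ ε) eq
      branching : Branching Image
      branching h′ (ε , kε , eq) with lift h′ eq
      ... | h , refl , sameSide , sameEnd with core-branching h kε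
      ...   | h₁ , h₁≢h , kh₁ , same with old (edge h₁) kh₁
      ...     | ε₁′ , eq₁ = mapEnd (λ _ → ε₁′) h₁ , distinct ,
                subst Image (sym (edge-mapEnd _ h₁)) (edge h₁ , kh₁ , eq₁) ,
                vertex-injective occ _ _ (trans (sym (moved h₁ eq₁)) (trans (cong (vmap q) same) sameEnd))
        where
        same-side : ∀ h h₁ {c c₁} → mapEnd (λ _ → c₁) h₁ ≡ mapEnd (λ _ → c) h → edge h₁ ≡ edge h → h₁ ≡ h
        same-side (inj₁ _) (inj₁ _) _ refl = refl
        same-side (inj₂ _) (inj₂ _) _ refl = refl
        -- The passage between ends of `q` and of `p` preserves the side, and injectivity of
        -- `emap q` identifies the edges, so different ends cannot be merged.
        distinct : mapEnd (λ _ → ε₁′) h₁ ≢ h′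
        distinct eq′ = h₁≢h (same-side h h₁ (trans eq′ (sym sameSide)) (edge-injective occ′ _ _
          (trans eq₁ (trans (cong (emap p) (trans (sym (edge-mapEnd _ h₁)) (cong edge eq′))) (sym eq)))))
      within : Within p q
      within ε kε = let (ε′ , eq) = old ε kε in ε′ , core-maximal {Image} branching (ε , kε , eq) , eq

    new-at : ∀ h → ¬ Meet p q (at h) → New p q (edge h)
    new-at (inj₁ ε) ¬meet ε′ eq = ¬meet (src T ε′ , proj₁ (proj₂ (occ-end occ′ occ eq)))
    new-at (inj₂ ε) ¬meet ε′ eq = ¬meet (tgt T ε′ , proj₂ (proj₂ (occ-end occ′ occ eq)))

  -- What must be remembered of a switching: the redirected edge and, for each of its ends, a vertex
  -- of `p` and a vertex of `q` with the same image. There are `e * v^4` tags, a number independent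
  -- of `n`.
  Tag : Set
  Tag = Fin (nE T) × ((Fin (nV T) × Fin (nV T)) × (Fin (nV T) × Fin (nV T)))

  tags : List Tag
  tags = cartesianProduct (allFin (nE T))
    (cartesianProduct (cartesianProduct (allFin (nV T)) (allFin (nV T))) (cartesianProduct (allFin (nV T)) (allFin (nV T))))

  -- The outcome consists of a tag, the switched tuple `τ` and a listed copy `p′` of `p`; `q` is not
  -- part of it. The meeting points, the routes and `rest` are what allows `q` to be rebuilt.
  record Switched {n : ℕ} (z : (Tuple n k × (Emb n × Emb n)) × Fin n) (t : Tag × (Tuple n k × Emb n)) : Set where
    σ = proj₁ (proj₁ z)
    p = proj₁ (proj₂ (proj₁ z))
    q = proj₂ (proj₂ (proj₁ z))
    b = proj₂ z
    ε = proj₁ (proj₁ t)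
    x₁ = proj₁ (proj₁ (proj₂ (proj₁ t)))
    y₁ = proj₂ (proj₁ (proj₂ (proj₁ t)))
    x₂ = proj₁ (proj₂ (proj₂ (proj₁ t)))
    y₂ = proj₂ (proj₂ (proj₂ (proj₁ t)))
    τ = proj₁ (proj₂ t)
    p′ = proj₂ (proj₂ t)
    field
      σ-perm : IsPermTuple σ
      τ-perm : IsPermTuple τ
      q-occ : Occ σ q
      p≈p′ : p ≈ᴱ p′
      meet₁ : vmap q y₁ ≡ vmap p′ x₁
      meet₂ : vmap q y₂ ≡ vmap p′ x₂
      route₁ : Route (_≢ ε) y₁ (src T ε)
      route₂ : Route (_≢ ε) y₂ (tgt T ε)
      rest : ∀ {ε′} → ε′ ≢ ε → τ (lab T ε′) (vmap q (src T ε′)) ≡ vmap q (tgt T ε′)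
      switched : switch (lab T ε) (vmap q (tgt T ε)) b σ ≋ τ

  -- The images of `y₁` and `y₂` under `q` are read off from `p′`. Routes avoiding `ε` carry them
  -- under `τ` to both ends of `ε`. Then `b` is the value of `τ` at the source, the old value is the
  -- image of the target, and undoing the switch gives `σ`. Finally `σ` and one meeting point
  -- determine `q`.
  switched-injective : Connected T → ∀ {n} {z z′ : (Tuple n k × (Emb n × Emb n)) × Fin n} {t} →
    Switched z t → Switched z′ t → proj₁ z ≈³ proj₁ z′ × proj₂ z ≡ proj₂ z′
  switched-injective connected {z = z} {z′} {t} S S′ =
    (σ≋σ′ , ((λ x → trans (proj₁ S.p≈p′ x) (sym (proj₁ S′.p≈p′ x))) , (λ e → trans (proj₂ S.p≈p′ e) (sym (proj₂ S′.p≈p′ e)))) ,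
      occ-determined connected S.σ-perm S.q-occ
        (occ-resp (λ j i → sym (σ≋σ′ j i)) ((λ _ → refl) , (λ _ → refl)) S′.q-occ) same₁) , b≡b′
    where
    module S = Switched S
    module S′ = Switched S′
    same₁ : vmap S.q S.y₁ ≡ vmap S′.q S.y₁
    same₁ = trans S.meet₁ (sym S′.meet₁)
    same-src : vmap S.q (src T S.ε) ≡ vmap S′.q (src T S.ε)
    same-src = propagate S.τ-perm S.rest S′.rest S.route₁ same₁
    same-tgt : vmap S.q (tgt T S.ε) ≡ vmap S′.q (tgt T S.ε)
    same-tgt = propagate S.τ-perm S.rest S′.rest S.route₂ (trans S.meet₂ (sym S′.meet₂))
    redirected : ∀ {z} (S : Switched z t) → let open Switched S in τ (lab T ε) (vmap q (src T ε)) ≡ b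
    redirected S = trans (sym (switched _ _)) (switch-at _ _ b σ (occ-follows q-occ ε))
      where open Switched S
    b≡b′ : S.b ≡ S′.b
    b≡b′ = trans (sym (redirected S)) (trans (cong (S.τ _) same-src) (redirected S′))
    σ≋σ′ : S.σ ≋ S′.σ
    σ≋σ′ = switch-injective (lab T S.ε) (vmap S.q (tgt T S.ε)) S.b (λ j i → trans (S.switched j i)
      (sym (subst₂ (λ a b → switch (lab T S.ε) a b S′.σ j i ≡ S.τ j i) (sym same-tgt) (sym b≡b′) (S′.switched j i))))

  -- A straddling pair has a new edge both of whose ends can be located from p
  -- without using that edge, so redirecting its image loses no information;
  -- there are about n ways to redirect it, hence straddling pairs are rare.
  length-straddling-≤ : Connected T → ∀ n →
    (n ∸ (nV T + nV T)) * length (tuplePairsWith {n} straddling?) ≤ length tags * length (occPairs n)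
  length-straddling-≤ connected n = begin
    (n ∸ (nV T + nV T)) * length (tuplePairsWith {n} straddling?)
      ≤⟨ length-distinct-pairs-≤ {_≈A_ = _≈³_} (λ (_ , (p , q)) → free p q) Switched
           (tuplePairs-distinct straddling?) (λ {(_ , (p , q))} _ → fresh-distinct (used p q))
           (λ {(_ , (p , q))} _ → length-fresh (used p q) (length-used p q)) redirect (switched-injective connected) ⟩
    length (cartesianProduct tags (occPairs n))
      ≡⟨ length-cartesianProduct tags (occPairs n) ⟩
    length tags * length (occPairs n) ∎
    where
    open ≤-Reasoning
    -- Avoiding all vertices of both occurrences ensures that no edge of either has target `b`; this
    -- costs at most `nV T + nV T` of the `n` values.
    used : Emb n → Emb n → List (Fin n)
    used p q = tabulate (vmap p) ++ tabulate (vmap q)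
    free : Emb n → Emb n → List (Fin n)
    free p q = fresh (used p q)
    length-used : ∀ p q → length (used p q) ≡ nV T + nV T
    length-used p q = trans (length-++ (tabulate (vmap p))) (cong₂ _+_ (length-tabulate (vmap p)) (length-tabulate (vmap q)))
    redirect : ∀ {z b} → z ∈ tuplePairsWith {n} straddling? → b ∈ free (proj₁ (proj₂ z)) (proj₂ (proj₂ z)) →
      ∃[ t ] (t ∈ cartesianProduct tags (occPairs n) × Switched (z , b) t)
    redirect {b = b} z∈ b∈ with ∈-tuplePairs⁻ straddling? z∈
    ... | σ , p , q , refl , σ∈ , p∈ , q∈ , ((y₀ , meet₀) , ¬within)
        with occs-sound {σ = σ} {p} p∈ | occs-sound {σ = σ} {q} q∈
    ...   | _ , occ | _ , occ′
          with new-kept-edge occ occ′ ¬within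
    ...     | ε₀ , kε₀ , new₀
            with Anchored.anchored-new-edge connected (meet? p q) meet₀ core-branching (new? p q) (new-at occ occ′) kε₀ new₀
    ...       | ε , new , (y₁ , (x₁ , meet₁) , route₁) , (y₂ , (x₂ , meet₂) , route₂) =
      let ((τ , p′) , z′∈ , σ′≋τ , p≈p′) = occPairs-complete (switch-perm l a b perm) p-occ in
      ((ε , (x₁ , y₁) , (x₂ , y₂)) , (τ , p′)) ,
      ∈-cartesianProduct⁺
        (∈-cartesianProduct⁺ (∈-allFin ε) (∈-cartesianProduct⁺ (∈-cartesianProduct⁺ (∈-allFin x₁) (∈-allFin y₁))
                                                               (∈-cartesianProduct⁺ (∈-allFin x₂) (∈-allFin y₂)))) z′∈ ,
      record
        { σ-perm = perm
        ; τ-perm = λ j x y eq → switch-perm l a b perm j x y (trans (σ′≋τ j x) (trans eq (sym (σ′≋τ j y))))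
        ; q-occ = occ′
        ; p≈p′ = p≈p′
        ; meet₁ = trans meet₁ (proj₁ p≈p′ x₁)
        ; meet₂ = trans meet₂ (proj₁ p≈p′ x₂)
        ; route₁ = route₁
        ; route₂ = route₂
        ; rest = λ ε′≢ε → trans (sym (σ′≋τ _ _)) (q-rest _ ε′≢ε)
        ; switched = σ′≋τ
        }
      where
      perm : IsPermTuple σ
      perm = tuples-perm σ∈
      l = lab T ε
      a = vmap q (tgt T ε)
      σ′ : Tuple n k
      σ′ = switch l a b σ
      -- An edge with label `l` and target `a` has, by injectivity of `σ l`, the same image as `ε`
      -- under `q`. So `p` survives because `ε` is new, and `q` survives away from `ε`.
      unaffected : ∀ {r} → Occ σ r → b ∉ tabulate (vmap r) → ∀ ε′ → emap r ε′ ≢ emap q ε →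
        σ′ (lab T ε′) (vmap r (src T ε′)) ≡ vmap r (tgt T ε′)
      unaffected {r} rocc b∉ ε′ ≢ε = trans (switch-other l a b σ
        (λ { sameLab sameTgt → ≢ε (trans (occ-edge rocc ε′) (trans (cong₂ _,_
               (perm l _ _ (trans (cong (λ j → σ j (vmap r (src T ε′))) (sym sameLab)) (trans sameTgt (sym (occ-follows occ′ ε))))) sameLab)
               (sym (occ-edge occ′ ε)))) })
        (λ _ eq → b∉ (subst (_∈ tabulate (vmap r)) (trans (sym (occ-follows rocc ε′)) eq) (∈-tabulate⁺ (tgt T ε′)))))
        (occ-follows rocc ε′)
      p-occ : Occ σ′ p
      p-occ = occurrence (vertex-injective occ) (edge-injective occ) (occ-edge occ)
        (λ ε′ → unaffected occ (λ b∈p → ∈-fresh⁻ b∈ (∈-++⁺ˡ b∈p)) ε′ (λ eq → new ε′ (sym eq)))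
      q-rest : ∀ ε′ → ε′ ≢ ε → σ′ (lab T ε′) (vmap q (src T ε′)) ≡ vmap q (tgt T ε′)
      q-rest ε′ ε′≢ε = unaffected occ′ (λ b∈q → ∈-fresh⁻ b∈ (∈-++⁺ʳ (tabulate (vmap p)) b∈q)) ε′
        (λ eq → ε′≢ε (edge-injective occ′ _ _ eq))

-- The Bonferroni inequality and asymptotic estimates

length-filter-split : ∀ {A : Set} {P : A → Set} (P? : Decidable P) xs →
  length (filter P? xs) + length (filter (¬? ∘ P?) xs) ≡ length xs
length-filter-split P? [] = refl
length-filter-split P? (x ∷ xs) with P? x
... | yes _ = cong suc (length-filter-split P? xs)
... | no _ = trans (+-suc _ _) (cong suc (length-filter-split P? xs))

length-filter-mono : ∀ {A : Set} {P Q : A → Set} (P? : Decidable P) (Q? : Decidable Q) →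
  (∀ {x} → P x → Q x) → ∀ xs → length (filter P? xs) ≤ length (filter Q? xs)
length-filter-mono P? Q? P⇒Q [] = z≤n
length-filter-mono P? Q? P⇒Q (x ∷ xs) with P? x | Q? x
... | yes _ | yes _ = s≤s (length-filter-mono P? Q? P⇒Q xs)
... | yes p | no ¬q = contradiction (P⇒Q p) ¬q
... | no _  | yes _ = ≤-trans (length-filter-mono P? Q? P⇒Q xs) (n≤1+n _)
... | no _  | no _  = length-filter-mono P? Q? P⇒Q xs

sum-≥-const : ∀ {A : Set} (f : A → ℕ) w xs → (∀ {x} → x ∈ xs → w ≤ f x) → w * length xs ≤ sum (map f xs)
sum-≥-const f w [] _ = ≤-reflexive (*-zeroʳ w)
sum-≥-const f w (x ∷ xs) le =
  ≤-trans (≤-reflexive (*-suc w (length xs))) (+-mono-≤ (le (here refl)) (sum-≥-const f w xs (le ∘ there)))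

sum-≥-split : ∀ {A : Set} {P : A → Set} (P? : Decidable P) (f : A → ℕ) {u w} xs →
  (∀ {x} → P x → u ≤ f x) → (∀ {x} → ¬ P x → w ≤ f x) →
  u * length (filter P? xs) + w * length (filter (¬? ∘ P?) xs) ≤ sum (map f xs)
sum-≥-split P? f {u} {w} [] _ _ = ≤-reflexive (cong₂ _+_ (*-zeroʳ u) (*-zeroʳ w))
sum-≥-split P? f {u} {w} (x ∷ xs) onP offP with P? x
... | yes p = ≤-trans (≤-reflexive (eq u _ _)) (+-mono-≤ (onP p) (sum-≥-split P? f xs onP offP))
  where
  eq : ∀ u a b → u * suc a + b ≡ u + (u * a + b)
  eq = solve-∀
... | no ¬p = ≤-trans (≤-reflexive (eq w _ _)) (+-mono-≤ (offP ¬p) (sum-≥-split P? f xs onP offP))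
  where
  eq : ∀ w a b → b + w * suc a ≡ w + (b + w * a)
  eq = solve-∀

-- This is `(c - s)(c - d) ≥ 0` without subtraction.
rectangle : ∀ {c s d} → s ≤ c → d ≤ c → c * s + c * d ≤ c * c + s * d
rectangle {c} {s} {d} s≤c d≤c with m≤n⇒∃[o]m+o≡n d≤c
... | j , refl = ≤-trans (≤-reflexive (eq s d j)) (≤-trans (+-monoˡ-≤ _ (*-monoˡ-≤ j s≤c)) (≤-reflexive (eq′ s d j)))
  where
  eq : ∀ s d j → (d + j) * s + (d + j) * d ≡ s * j + (s * d + (d + j) * d)
  eq = solve-∀
  eq′ : ∀ s d j → (d + j) * j + (s * d + (d + j) * d) ≡ (d + j) * (d + j) + s * d
  eq′ = solve-∀

module Bonferroni {A : Set} {_~_ : A → A → Set} (_~?_ : ∀ x y → Dec (x ~ y))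
  (~-sym : ∀ {x y} → x ~ y → y ~ x) (~-trans : ∀ {x y z} → x ~ y → y ~ z → x ~ z)
  (xs : List A) {c : ℕ} where

  others : A → List A
  others x = filter (λ y → ¬? (x ~? y)) xs

  -- With t = |xs| / c and weights at most 1 on the classes, this is the
  -- inequality t - (sum of the products over unordered pairs) ≤ 1.
  bonferroni : (∀ {x} → x ∈ xs → length (filter (x ~?_) xs) ≤ c) →
    2 * c * length xs ≤ 2 * c * c + length (pairs others xs)
  bonferroni small rewrite length-join _,_ others xs with Any.any? (λ x → length (others x) ≤? c) xs
  -- Some `x` has `d ≤ c` nonequivalents and a class of size `s ≤ c`. Members of that class have `d`
  -- nonequivalents each, and all other elements at least `s`, namely the class of `x`; so there are
  -- at least `2sd` ordered pairs.
  ... | yes few =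
    let (x , x∈ , d≤c) = find few
        s = length (filter (x ~?_) xs)
        d = length (others x)
    in begin
      2 * c * length xs                    ≡⟨ cong (2 * c *_) (length-filter-split (x ~?_) xs) ⟨
      2 * c * (s + d)                      ≡⟨ eq c s d ⟩
      2 * (c * s + c * d)                  ≤⟨ *-monoʳ-≤ 2 (rectangle (small x∈) d≤c) ⟩
      2 * (c * c + s * d)                  ≡⟨ eq′ c s d ⟩
      2 * c * c + (d * s + s * d)          ≤⟨ +-monoʳ-≤ (2 * c * c) (sum-≥-split (x ~?_) (length ∘ others) xs
        (λ {y} x~y → length-filter-mono _ _ (λ ¬x~z y~z → ¬x~z (~-trans x~y y~z)) xs)
        (λ {y} ¬x~y → length-filter-mono _ _ (λ x~z y~z → ¬x~y (~-trans x~z (~-sym y~z))) xs)) ⟩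
      2 * c * c + sum (map (length ∘ others) xs) ∎
    where
    open ≤-Reasoning
    eq : ∀ c s d → 2 * c * (s + d) ≡ 2 * (c * s + c * d)
    eq = solve-∀
    eq′ : ∀ c s d → 2 * (c * c + s * d) ≡ 2 * c * c + (d * s + s * d)
    eq′ = solve-∀
  ... | no many with ≤-total (length xs) (2 * c)
  -- Every element now has at least `c` nonequivalents, which pays for one of the two terms
  -- `c * length xs`; the length bound pays for the other.
  ...   | inj₁ X≤2c = begin
      2 * c * length xs                            ≡⟨ eq c (length xs) ⟩
      c * length xs + c * length xs                ≤⟨ +-mono-≤ (*-monoʳ-≤ c X≤2c) (sum-≥-const (length ∘ others) c xs
        (λ x∈ → ≰⇒≥ (λ le → many (lose x∈ le)))) ⟩
      c * (2 * c) + sum (map (length ∘ others) xs) ≡⟨ cong (_+ sum (map (length ∘ others) xs)) (eq′ c) ⟩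
      2 * c * c + sum (map (length ∘ others) xs)   ∎
    where
    open ≤-Reasoning
    eq : ∀ c x → 2 * c * x ≡ c * x + c * x
    eq = solve-∀
    eq′ : ∀ c → c * (2 * c) ≡ 2 * c * c
    eq′ = solve-∀
  -- With `2c + i` elements and classes of size at most `c`, each element has at least `c + i`
  -- nonequivalents.
  ...   | inj₂ 2c≤X with m≤n⇒∃[o]m+o≡n 2c≤X
  ...     | i , 2c+i≡X = begin
      2 * c * length xs                            ≡⟨ cong (2 * c *_) 2c+i≡X ⟨
      2 * c * (2 * c + i)                          ≤⟨ m≤m+n _ (c * i + i * i) ⟩
      2 * c * (2 * c + i) + (c * i + i * i)        ≡⟨ eq c i ⟩
      2 * c * c + (c + i) * (2 * c + i)            ≡⟨ cong (λ x → 2 * c * c + (c + i) * x) 2c+i≡X ⟩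
      2 * c * c + (c + i) * length xs              ≤⟨ +-monoʳ-≤ (2 * c * c) (sum-≥-const (length ∘ others) (c + i) xs far) ⟩
      2 * c * c + sum (map (length ∘ others) xs)   ∎
    where
    open ≤-Reasoning
    eq : ∀ c i → 2 * c * (2 * c + i) + (c * i + i * i) ≡ 2 * c * c + (c + i) * (2 * c + i)
    eq = solve-∀
    eq′ : ∀ c i → c + (c + i) ≡ 2 * c + i
    eq′ = solve-∀
    far : ∀ {x} → x ∈ xs → c + i ≤ length (others x)
    far {x} x∈ = +-cancelˡ-≤ c _ _ (begin
      c + (c + i)                                          ≡⟨ trans (eq′ c i) 2c+i≡X ⟩
      length xs                                            ≡⟨ length-filter-split (x ~?_) xs ⟨
      length (filter (x ~?_) xs) + length (others x)       ≤⟨ +-monoˡ-≤ _ (small x∈) ⟩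
      c + length (others x)                                ∎)

-- Bernoulli's inequality `(1 - E/n)^j ≥ 1 - Ej/n` cleared of denominators; with truncated
-- subtraction it also holds for `n < E`.
power-deficit : ∀ n E j → n ^ j * n ≤ (n ∸ E) ^ j * n + E * j * n ^ j
power-deficit n E zero = m≤m+n _ _
power-deficit n E (suc j) = begin
  n * p * n                                            ≡⟨ *-assoc n p n ⟩
  n * (p * n)                                          ≤⟨ *-monoʳ-≤ n (power-deficit n E j) ⟩
  n * (q * n + E * j * p)                              ≡⟨ eq n q E j p ⟩
  n * (q * n) + E * j * (n * p)                        ≤⟨ +-monoˡ-≤ _ (*-monoˡ-≤ (q * n) (≤-trans (m≤n+m∸n n E) (≤-reflexive (+-comm E (n ∸ E))))) ⟩
  ((n ∸ E) + E) * (q * n) + E * j * (n * p)            ≡⟨ eq′ (n ∸ E) E q n (E * j * (n * p)) ⟩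
  (n ∸ E) * q * n + (E * (q * n) + E * j * (n * p))    ≤⟨ +-monoʳ-≤ ((n ∸ E) * q * n) (+-monoˡ-≤ (E * j * (n * p)) (*-monoʳ-≤ E (≤-trans (*-monoˡ-≤ n (^-monoˡ-≤ j (m∸n≤m n E))) (≤-reflexive (*-comm p n))))) ⟩
  (n ∸ E) * q * n + (E * (n * p) + E * j * (n * p))    ≡⟨ eq″ E j ((n ∸ E) * q * n) (n * p) ⟩
  (n ∸ E) * q * n + E * suc j * (n * p)                ∎
  where
  open ≤-Reasoning
  p = n ^ j
  q = (n ∸ E) ^ j
  eq : ∀ n q E j p → n * (q * n + E * j * p) ≡ n * (q * n) + E * j * (n * p)
  eq = solve-∀
  eq′ : ∀ m E q n z → (m + E) * (q * n) + z ≡ m * q * n + (E * (q * n) + z)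
  eq′ = solve-∀
  eq″ : ∀ E j z w → z + (E * w + E * j * w) ≡ z + E * suc j * w
  eq″ = solve-∀

module _ {n : ℕ} .{{_ : NonZero n}} (S M r v : ℕ) where

  private
    instance
      n^v≢0 : NonZero (n ^ v)
      n^v≢0 = m^n≢0 n v
    A = n ^ r

  -- Bernoulli's inequality leaves an error term containing the unknown `S * A` (`crude`). Since
  -- `2 * (E * E) ≤ n`, it is at most half of the left side, so `S * A ≤ 2 * M`, and this is
  -- substituted back.
  mean-upper : ∀ {E} → E ≡ r + v → (n ∸ E) ^ E * S ≤ n ^ v * M → 2 * (E * E) ≤ n →
    S * A * n ≤ M * n + 2 * (E * E) * M
  mean-upper {E} E≡ bound large = begin
    S * A * n                  ≤⟨ crude ⟩
    M * n + E * E * (S * A)    ≤⟨ +-monoʳ-≤ (M * n) (*-monoʳ-≤ (E * E) SA≤2M) ⟩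
    M * n + E * E * (2 * M)    ≡⟨ eq₁ (M * n) (E * E) M ⟩
    M * n + 2 * (E * E) * M    ∎
    where
    open ≤-Reasoning
    eq₁ : ∀ z e m → z + e * (2 * m) ≡ z + 2 * e * m
    eq₁ = solve-∀
    eq₂ : ∀ V S A n → V * (S * A * n) ≡ S * (A * V * n)
    eq₂ = solve-∀
    eq₃ : ∀ S q n e A V → S * (q * n + e * (A * V)) ≡ q * S * n + V * (e * (S * A))
    eq₃ = solve-∀
    eq₄ : ∀ V M n z → V * M * n + V * z ≡ V * (M * n + z)
    eq₄ = solve-∀
    n^E : n ^ E ≡ A * n ^ v
    n^E = trans (cong (n ^_) E≡) (^-distribˡ-+-* n r v)
    crude : S * A * n ≤ M * n + E * E * (S * A)
    crude = *-cancelˡ-≤ (n ^ v) (begin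
      n ^ v * (S * A * n)                                   ≡⟨ eq₂ (n ^ v) S A n ⟩
      S * (A * n ^ v * n)                                   ≡⟨ cong (λ p → S * (p * n)) n^E ⟨
      S * (n ^ E * n)                                       ≤⟨ *-monoʳ-≤ S (power-deficit n E E) ⟩
      S * ((n ∸ E) ^ E * n + E * E * n ^ E)                 ≡⟨ cong (λ p → S * ((n ∸ E) ^ E * n + E * E * p)) n^E ⟩
      S * ((n ∸ E) ^ E * n + E * E * (A * n ^ v))           ≡⟨ eq₃ S ((n ∸ E) ^ E) n (E * E) A (n ^ v) ⟩
      (n ∸ E) ^ E * S * n + n ^ v * (E * E * (S * A))       ≤⟨ +-monoˡ-≤ _ (*-monoˡ-≤ n bound) ⟩
      n ^ v * M * n + n ^ v * (E * E * (S * A))             ≡⟨ eq₄ (n ^ v) M n (E * E * (S * A)) ⟩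
      n ^ v * (M * n + E * E * (S * A))                     ∎)
    eq₅ : ∀ y n → y * n + n * y ≡ 2 * (y * n)
    eq₅ = solve-∀
    eq₆ : ∀ m n e y → 2 * (m * n + e * y) ≡ 2 * m * n + 2 * e * y
    eq₆ = solve-∀
    SA≤2M : S * A ≤ 2 * M
    SA≤2M = *-cancelʳ-≤ (S * A) (2 * M) n (+-cancelʳ-≤ (n * (S * A)) _ _ (begin
      S * A * n + n * (S * A)               ≡⟨ eq₅ (S * A) n ⟩
      2 * (S * A * n)                       ≤⟨ *-monoʳ-≤ 2 crude ⟩
      2 * (M * n + E * E * (S * A))         ≡⟨ eq₆ M n (E * E) (S * A) ⟩
      2 * M * n + 2 * (E * E) * (S * A)     ≤⟨ +-monoʳ-≤ (2 * M * n) (*-monoˡ-≤ (S * A) large) ⟩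
      2 * M * n + n * (S * A)               ∎))

  mean-lower : (n ∸ v) ^ v * M ≤ n ^ (r + v) * S → M * n ≤ S * A * n + v * v * M
  mean-lower bound = *-cancelˡ-≤ (n ^ v) (begin
    n ^ v * (M * n)                                  ≡⟨ eq₁ (n ^ v) M n ⟩
    n ^ v * n * M                                    ≤⟨ *-monoˡ-≤ M (power-deficit n v v) ⟩
    ((n ∸ v) ^ v * n + v * v * n ^ v) * M            ≡⟨ eq₂ ((n ∸ v) ^ v) n (v * v) (n ^ v) M ⟩
    (n ∸ v) ^ v * M * n + n ^ v * (v * v * M)        ≤⟨ +-monoˡ-≤ _ (*-monoˡ-≤ n bound) ⟩
    n ^ (r + v) * S * n + n ^ v * (v * v * M)        ≡⟨ cong (λ p → p * S * n + n ^ v * (v * v * M)) (^-distribˡ-+-* n r v) ⟩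
    A * n ^ v * S * n + n ^ v * (v * v * M)          ≡⟨ eq₃ A (n ^ v) S n (v * v * M) ⟩
    n ^ v * (S * A * n + v * v * M)                  ∎)
    where
    open ≤-Reasoning
    eq₁ : ∀ V M n → V * (M * n) ≡ V * n * M
    eq₁ = solve-∀
    eq₂ : ∀ q n e V M → (q * n + e * V) * M ≡ q * M * n + V * (e * M)
    eq₂ = solve-∀
    eq₃ : ∀ A V S n z → A * V * S * n + V * z ≡ V * (S * A * n + z)
    eq₃ = solve-∀

-- A stands for nʳ and Q for 2c²n²ʳ.
combine-bounds : ∀ {c n A M S P D B C₁ C₂ C₃} → 1 ≤ c → 1 ≤ A →
  M * n ≤ S * A * n + C₁ * M →
  2 * c * S ≤ 2 * c * c * P + (D + 2 * B) →
  D * (A * A) * n ≤ M * n + C₂ * M →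
  B * A * n ≤ C₃ * M →
  let Q = 2 * c * c * (A * A) in
  M * Q * (n * A) ≤ ((P * Q + M) * (n * A) + (C₁ + C₂ + C₃) * (M * Q)) * (c * A)
combine-bounds {c} {n} {A} {M} {S} {P} {D} {B} {C₁} {C₂} {C₃} 1≤c 1≤A lower second disjoint straddle = begin
  M * (2 * c * c * (A * A)) * (n * A)
    ≡⟨ eq₁ M c A n ⟩
  c * A * A * (2 * c * A * (M * n))
    ≤⟨ *-monoʳ-≤ (c * A * A) main ⟩
  c * A * A * (2 * c * c * P * (A * A) * n + M * n + (2 * c * A * C₁ * M + C₂ * M + 2 * A * C₃ * M))
    ≤⟨ *-monoʳ-≤ (c * A * A) (+-monoʳ-≤ (2 * c * c * P * (A * A) * n + M * n) error) ⟩
  c * A * A * (2 * c * c * P * (A * A) * n + M * n + 2 * c * c * A * ((C₁ + C₂ + C₃) * M))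
    ≡⟨ eq₂ c A P n M (C₁ + C₂ + C₃) ⟩
  ((P * (2 * c * c * (A * A)) + M) * (n * A) + (C₁ + C₂ + C₃) * (M * (2 * c * c * (A * A)))) * (c * A) ∎
  where
  open ≤-Reasoning
  eq₁ : ∀ M c A n → M * (2 * c * c * (A * A)) * (n * A) ≡ c * A * A * (2 * c * A * (M * n))
  eq₁ = solve-∀
  eq₂ : ∀ c A P n M C → c * A * A * (2 * c * c * P * (A * A) * n + M * n + 2 * c * c * A * (C * M))
      ≡ ((P * (2 * c * c * (A * A)) + M) * (n * A) + C * (M * (2 * c * c * (A * A)))) * (c * A)
  eq₂ = solve-∀
  eq₃ : ∀ c A S n z → 2 * c * A * (S * A * n + z) ≡ 2 * c * S * (A * A * n) + 2 * c * A * z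
  eq₃ = solve-∀
  eq₄ : ∀ c P D B A n z → (2 * c * c * P + (D + 2 * B)) * (A * A * n) + z
      ≡ 2 * c * c * P * (A * A) * n + (D * (A * A) * n + 2 * A * (B * A * n) + z)
  eq₄ = solve-∀
  eq₅ : ∀ w m c A C₁ C₂ C₃ M → w + (m + C₂ * M + 2 * A * (C₃ * M) + 2 * c * A * (C₁ * M))
      ≡ w + m + (2 * c * A * C₁ * M + C₂ * M + 2 * A * C₃ * M)
  eq₅ = solve-∀
  -- The pair inequality `second` is scaled by `A * A * n`, at which the disjoint pairs `D` amount
  -- to `M * n` up to the error.
  main : 2 * c * A * (M * n) ≤ 2 * c * c * P * (A * A) * n + M * n + (2 * c * A * C₁ * M + C₂ * M + 2 * A * C₃ * M)
  main = begin
    2 * c * A * (M * n)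
      ≤⟨ *-monoʳ-≤ (2 * c * A) lower ⟩
    2 * c * A * (S * A * n + C₁ * M)
      ≡⟨ eq₃ c A S n (C₁ * M) ⟩
    2 * c * S * (A * A * n) + 2 * c * A * (C₁ * M)
      ≤⟨ +-monoˡ-≤ _ (*-monoˡ-≤ (A * A * n) second) ⟩
    (2 * c * c * P + (D + 2 * B)) * (A * A * n) + 2 * c * A * (C₁ * M)
      ≡⟨ eq₄ c P D B A n (2 * c * A * (C₁ * M)) ⟩
    2 * c * c * P * (A * A) * n + (D * (A * A) * n + 2 * A * (B * A * n) + 2 * c * A * (C₁ * M))
      ≤⟨ +-monoʳ-≤ (2 * c * c * P * (A * A) * n) (+-monoˡ-≤ _ (+-mono-≤ disjoint (*-monoʳ-≤ (2 * A) straddle))) ⟩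
    2 * c * c * P * (A * A) * n + (M * n + C₂ * M + 2 * A * (C₃ * M) + 2 * c * A * (C₁ * M))
      ≡⟨ eq₅ (2 * c * c * P * (A * A) * n) (M * n) c A C₁ C₂ C₃ M ⟩
    2 * c * c * P * (A * A) * n + M * n + (2 * c * A * C₁ * M + C₂ * M + 2 * A * C₃ * M) ∎
  eq₆ : ∀ c A C₁ C₂ C₃ M → 2 * c * A * C₁ * M + C₂ * M + 2 * A * C₃ * M
      ≡ c * (2 * A * C₁ * M) + (1 * 1 * (1 * (C₂ * M)) + 1 * 1 * (2 * A * C₃ * M))
  eq₆ = solve-∀
  eq₇ : ∀ c A C₁ C₂ C₃ M → c * c * (2 * A * C₁ * M) + (c * c * (2 * A * (C₂ * M)) + c * c * (2 * A * C₃ * M))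
      ≡ 2 * c * c * A * ((C₁ + C₂ + C₃) * M)
  eq₇ = solve-∀
  1≤c² : 1 * 1 ≤ c * c
  1≤c² = *-mono-≤ 1≤c 1≤c
  -- The three errors carry different powers of `c` and `A`; as both are at least 1, each
  -- coefficient may be raised to `2 * c * c * A`.
  error : 2 * c * A * C₁ * M + C₂ * M + 2 * A * C₃ * M ≤ 2 * c * c * A * ((C₁ + C₂ + C₃) * M)
  error = begin
    2 * c * A * C₁ * M + C₂ * M + 2 * A * C₃ * M
      ≡⟨ eq₆ c A C₁ C₂ C₃ M ⟩
    c * (2 * A * C₁ * M) + (1 * 1 * (1 * (C₂ * M)) + 1 * 1 * (2 * A * C₃ * M))
      ≤⟨ +-mono-≤ (*-monoˡ-≤ (2 * A * C₁ * M) (≤-trans (≤-reflexive (sym (*-identityˡ c))) (*-monoˡ-≤ c 1≤c)))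
           (+-mono-≤ (*-mono-≤ 1≤c² (*-monoˡ-≤ (C₂ * M) (*-mono-≤ (s≤s {n = 1} z≤n) 1≤A))) (*-monoˡ-≤ (2 * A * C₃ * M) 1≤c²)) ⟩
    c * c * (2 * A * C₁ * M) + (c * c * (2 * A * (C₂ * M)) + c * c * (2 * A * C₃ * M))
      ≡⟨ eq₇ c A C₁ C₂ C₃ M ⟩
    2 * c * c * A * ((C₁ + C₂ + C₃) * M) ∎

-- Arithmetic of fractions of natural numbers

ratio-fromℚᵘ : ∀ a b → toℚᵘ (ratio a (suc b)) ℚᵘ.≃ ℚᵘ.mkℚᵘ (ℤ.+ a) b
ratio-fromℚᵘ a b = ℚP.toℚᵘ-fromℚᵘ (ℚᵘ.mkℚᵘ (ℤ.+ a) b)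

ratio-≤ : ∀ a b c d .{{_ : NonZero b}} .{{_ : NonZero d}} → a * d ≤ c * b → ratio a b ≤ℚ ratio c d
ratio-≤ a (suc b) c (suc d) le = ℚP.toℚᵘ-cancel-≤ (begin
  toℚᵘ (ratio a (suc b))  ≃⟨ ratio-fromℚᵘ a b ⟩
  ℚᵘ.mkℚᵘ (ℤ.+ a) b         ≤⟨ ℚᵘ.*≤* (subst₂ ℤ._≤_ (ℤP.pos-* a (suc d)) (ℤP.pos-* c (suc b)) (ℤ.+≤+ le)) ⟩
  ℚᵘ.mkℚᵘ (ℤ.+ c) d         ≃⟨ ratio-fromℚᵘ c d ⟨
  toℚᵘ (ratio c (suc d))  ∎)
  where open ℚᵘP.≤-Reasoning

ratio-+ : ∀ a b c d .{{_ : NonZero b}} .{{_ : NonZero d}} →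
  ratio a b +ℚ ratio c d ≡ ratio (a * d + c * b) (b * d)
ratio-+ a (suc b) c (suc d) = ℚP.toℚᵘ-injective (begin
  toℚᵘ (ratio a (suc b) +ℚ ratio c (suc d))           ≈⟨ ℚP.toℚᵘ-homo-+ (ratio a (suc b)) (ratio c (suc d)) ⟩
  toℚᵘ (ratio a (suc b)) ℚᵘ.+ toℚᵘ (ratio c (suc d))  ≈⟨ ℚᵘP.+-cong (ratio-fromℚᵘ a b) (ratio-fromℚᵘ c d) ⟩
  ℚᵘ.mkℚᵘ (ℤ.+ a) b ℚᵘ.+ ℚᵘ.mkℚᵘ (ℤ.+ c) d                ≡⟨ cong (λ z → ℚᵘ.mkℚᵘ z (d + b * suc d)) (cong₂ ℤ._+_ (ℤP.pos-* a (suc d)) (ℤP.pos-* c (suc b))) ⟨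
  ℚᵘ.mkℚᵘ (ℤ.+ (a * suc d + c * suc b)) (d + b * suc d) ≈⟨ ratio-fromℚᵘ (a * suc d + c * suc b) (d + b * suc d) ⟨
  toℚᵘ (ratio (a * suc d + c * suc b) (suc b * suc d)) ∎)
  where open import Relation.Binary.Reasoning.Setoid ℚᵘP.≃-setoid

ratio-* : ∀ a c d .{{_ : NonZero d}} → ratio a 1 *ℚ ratio c d ≡ ratio (a * c) d
ratio-* a c (suc d) = ℚP.toℚᵘ-injective (begin
  toℚᵘ (ratio a 1 *ℚ ratio c (suc d))           ≈⟨ ℚP.toℚᵘ-homo-* (ratio a 1) (ratio c (suc d)) ⟩
  toℚᵘ (ratio a 1) ℚᵘ.* toℚᵘ (ratio c (suc d))  ≈⟨ ℚᵘP.*-cong (ratio-fromℚᵘ a 0) (ratio-fromℚᵘ c d) ⟩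
  ℚᵘ.mkℚᵘ (ℤ.+ a) 0 ℚᵘ.* ℚᵘ.mkℚᵘ (ℤ.+ c) d          ≡⟨ cong₂ ℚᵘ.mkℚᵘ (ℤP.pos-* a c) (sym (+-identityʳ d)) ⟨
  ℚᵘ.mkℚᵘ (ℤ.+ (a * c)) d                         ≈⟨ ratio-fromℚᵘ (a * c) d ⟨
  toℚᵘ (ratio (a * c) (suc d))                  ∎)
  where open import Relation.Binary.Reasoning.Setoid ℚᵘP.≃-setoid

≤+⇒-≤ : ∀ {p q s} → p ≤ℚ s +ℚ q → p -ℚ q ≤ℚ s
≤+⇒-≤ {p} {q} {s} le = subst (p -ℚ q ≤ℚ_) (begin
  s +ℚ q -ℚ q     ≡⟨ ℚP.+-assoc s q (-ℚ q) ⟩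
  s +ℚ (q -ℚ q)   ≡⟨ cong (s +ℚ_) (ℚP.+-inverseʳ q) ⟩
  s +ℚ 0ℚ ≡⟨ ℚP.+-identityʳ s ⟩
  s               ∎) (ℚP.+-monoˡ-≤ (-ℚ q) le)
  where open ≡-Reasoning

∣-∣-≤ : ∀ {p q z} → p ≤ℚ q +ℚ z → q ≤ℚ p +ℚ z → ∣ p -ℚ q ∣ ≤ℚ z
∣-∣-≤ {p} {q} {z} p≤ q≤ with ℚP.∣p∣≡p∨∣p∣≡-p (p -ℚ q)
... | inj₁ eq = subst (_≤ℚ z) (sym eq) (≤+⇒-≤ (subst (p ≤ℚ_) (ℚP.+-comm q z) p≤))
... | inj₂ eq = subst (_≤ℚ z) (sym (trans eq (⁻¹-anti-homo-// p q))) (≤+⇒-≤ (subst (q ≤ℚ_) (ℚP.+-comm p z) q≤))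

-- First and second moment

first-moment-ℚ : ∀ {S M n A C₀ C₁} .{{_ : NonZero M}} .{{_ : NonZero n}} .{{_ : NonZero A}} →
  S * A * n ≤ M * n + C₀ * M → M * n ≤ S * A * n + C₁ * M →
  ∣ ratio S M -ℚ ratio 1 A ∣ ≤ℚ ratio (C₀ + C₁) 1 *ℚ ratio 1 (n * A)
first-moment-ℚ {S} {M} {n} {A} {C₀} {C₁} upper lower = ∣-∣-≤
  (subst (ratio S M ≤ℚ_) (sym (error 1 A)) (ratio-≤ S M _ (A * (n * A)) (begin
    S * (A * (n * A))                             ≡⟨ eq₁ S A n ⟩
    S * A * n * A                                 ≤⟨ *-monoˡ-≤ A (≤-trans upper (+-monoʳ-≤ (M * n) (*-monoˡ-≤ M (m≤m+n C₀ C₁)))) ⟩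
    (M * n + (C₀ + C₁) * M) * A                   ≡⟨ eq₂ M n (C₀ + C₁) A ⟩
    (1 * (n * A) + (C₀ + C₁) * 1 * A) * M         ∎)))
  (subst (ratio 1 A ≤ℚ_) (sym (error S M)) (ratio-≤ 1 A _ (M * (n * A)) (begin
    1 * (M * (n * A))                             ≡⟨ eq₃ M n A ⟩
    M * n * A                                     ≤⟨ *-monoˡ-≤ A (≤-trans lower (+-monoʳ-≤ (S * A * n) (*-monoˡ-≤ M (m≤n+m C₁ C₀)))) ⟩
    (S * A * n + (C₀ + C₁) * M) * A               ≡⟨ eq₄ S A n (C₀ + C₁) M ⟩
    (S * (n * A) + (C₀ + C₁) * 1 * M) * A         ∎)))
  where
  open ≤-Reasoning
  instance
    nA≢0 : NonZero (n * A)
    nA≢0 = m*n≢0 n A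
    AnA≢0 : NonZero (A * (n * A))
    AnA≢0 = m*n≢0 A (n * A)
    MnA≢0 : NonZero (M * (n * A))
    MnA≢0 = m*n≢0 M (n * A)
  error : ∀ a b .{{_ : NonZero b}} → ratio a b +ℚ ratio (C₀ + C₁) 1 *ℚ ratio 1 (n * A) ≡
    ratio (a * (n * A) + (C₀ + C₁) * 1 * b) (b * (n * A))
  error a b = trans (cong (ratio a b +ℚ_) (ratio-* (C₀ + C₁) 1 (n * A))) (ratio-+ a b ((C₀ + C₁) * 1) (n * A))
  eq₁ : ∀ S A n → S * (A * (n * A)) ≡ S * A * n * A
  eq₁ = solve-∀
  eq₂ : ∀ M n C A → (M * n + C * M) * A ≡ (1 * (n * A) + C * 1 * A) * M
  eq₂ = solve-∀
  eq₃ : ∀ M n A → 1 * (M * (n * A)) ≡ M * n * A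
  eq₃ = solve-∀
  eq₄ : ∀ S A n C M → (S * A * n + C * M) * A ≡ (S * (n * A) + C * 1 * M) * A
  eq₄ = solve-∀

second-moment-ℚ : ∀ {P M n A X Q C} .{{_ : NonZero M}} .{{_ : NonZero n}} .{{_ : NonZero A}} .{{_ : NonZero X}} .{{_ : NonZero Q}} →
  M * Q * (n * A) ≤ ((P * Q + M) * (n * A) + C * (M * Q)) * X →
  (ratio 1 X -ℚ ratio 1 Q -ℚ ratio C 1 *ℚ ratio 1 (n * A)) ≤ℚ ratio P M
second-moment-ℚ {P} {M} {n} {A} {X} {Q} {C} bound = ≤+⇒-≤ (≤+⇒-≤ (subst (ratio 1 X ≤ℚ_) (sym total)
  (ratio-≤ 1 X _ (M * (n * A) * Q) (begin
    1 * (M * (n * A) * Q)                                     ≡⟨ eq₁ M (n * A) Q ⟩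
    M * Q * (n * A)                                           ≤⟨ bound ⟩
    ((P * Q + M) * (n * A) + C * (M * Q)) * X                 ≡⟨ eq₂ P Q M (n * A) C X ⟩
    ((P * (n * A) + C * 1 * M) * Q + 1 * (M * (n * A))) * X   ∎))))
  where
  open ≤-Reasoning
  instance
    nA≢0 : NonZero (n * A)
    nA≢0 = m*n≢0 n A
    MnA≢0 : NonZero (M * (n * A))
    MnA≢0 = m*n≢0 M (n * A)
    MnAQ≢0 : NonZero (M * (n * A) * Q)
    MnAQ≢0 = m*n≢0 (M * (n * A)) Q
  total : ratio P M +ℚ ratio C 1 *ℚ ratio 1 (n * A) +ℚ ratio 1 Q ≡
    ratio ((P * (n * A) + C * 1 * M) * Q + 1 * (M * (n * A))) (M * (n * A) * Q)
  total = trans (cong (_+ℚ ratio 1 Q) (trans (cong (ratio P M +ℚ_) (ratio-* C 1 (n * A))) (ratio-+ P M (C * 1) (n * A))))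
    (ratio-+ (P * (n * A) + C * 1 * M) (M * (n * A)) 1 Q)
  eq₁ : ∀ M Z Q → 1 * (M * Z * Q) ≡ M * Q * Z
  eq₁ = solve-∀
  eq₂ : ∀ P Q M Z C X → ((P * Q + M) * Z + C * (M * Q)) * X ≡ ((P * Z + C * 1 * M) * Q + 1 * (M * Z)) * X
  eq₂ = solve-∀

-- Tuples without occurrences have `f x ≡ 0`, so `w` is charged only to the tuples satisfying `Q`;
-- their number is the numerator of the probability.
sum-bonferroni : ∀ {A : Set} {Q : A → Set} (Q? : Decidable Q) (f g : A → ℕ) {u w} xs →
  (∀ {x} → ¬ Q x → f x ≡ 0) → (∀ {x} → x ∈ xs → u * f x ≤ w + g x) →
  u * sum (map f xs) ≤ w * length (filter Q? xs) + sum (map g xs)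
sum-bonferroni Q? f g {u} {w} [] _ _ = ≤-reflexive (trans (*-zeroʳ u) (sym (trans (+-identityʳ _) (*-zeroʳ w))))
sum-bonferroni Q? f g {u} {w} (x ∷ xs) null bound with Q? x | sum-bonferroni Q? f g {u} {w} xs null (bound ∘ there)
... | yes _ | rest = begin
  u * (f x + sum (map f xs))                                       ≡⟨ *-distribˡ-+ u (f x) _ ⟩
  u * f x + u * sum (map f xs)                                     ≤⟨ +-mono-≤ (bound (here refl)) rest ⟩
  w + g x + (w * length (filter Q? xs) + sum (map g xs))            ≡⟨ eq w (g x) _ _ ⟩
  w * suc (length (filter Q? xs)) + (g x + sum (map g xs))          ∎
  where
  open ≤-Reasoning
  eq : ∀ w a b c → w + a + (w * b + c) ≡ w * suc b + (a + c)
  eq = solve-∀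
... | no ¬q | rest = begin
  u * (f x + sum (map f xs))                                       ≡⟨ cong (λ y → u * (y + sum (map f xs))) (null ¬q) ⟩
  u * sum (map f xs)                                               ≤⟨ rest ⟩
  w * length (filter Q? xs) + sum (map g xs)                        ≤⟨ +-monoʳ-≤ (w * length (filter Q? xs)) (m≤n+m _ (g x)) ⟩
  w * length (filter Q? xs) + (g x + sum (map g xs))                ∎
  where open ≤-Reasoning

module Moments {k : ℕ} (T : LGraph k) (tangle : IsTangle T) (r : ℕ) (order : nE T ≡ r + nV T) where

  open Occurrences T
  open OccurrencePairs T

  connected : Connected T
  connected = proj₁ tangle

  v e c C₀ C₁ C₂ C₃ : ℕ
  v = nV T
  e = nE T
  c = pruningAutCount T
  -- `C₀` and `C₂` come from `mean-upper` with `e` and `e + e` edges, `C₁` from `mean-lower`. In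
  -- `C₃` one factor 2 comes from `n ≤ 2(n - 2v)` and the other from bounding the expectation by
  -- twice its main term.
  C₀ = 2 * (e * e)
  C₁ = v * v
  C₂ = 2 * ((e + e) * (e + e))
  C₃ = 4 * length tags

  contained : ∃[ n ] Σ (Tuple n k) λ σ → ∃[ p ] (IsPermTuple σ × Occ σ p)
  contained = let (n , σ , perm , φ , ψ , isOcc) = proj₂ tangle in n , σ , (φ , ψ) , perm , occurs isOcc

  -- Containment in some graph of the model is used here: at each vertex there is one outgoing edge
  -- with a given label.
  out-distinct : ∀ {ε ε′} → SameOut (arc ε) (arc ε′) → ε ≡ ε′
  out-distinct {ε} {ε′} (same-lab , same-src) with contained
  ... | _ , σ , p , _ , occ = Occ.edge-injective occ ε ε′ (trans (occ-edge occ ε)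
    (trans (cong₂ _,_ (cong (vmap p) same-src) same-lab) (sym (occ-edge occ ε′))))

  in-distinct : ∀ {ε ε′} → SameIn (arc ε) (arc ε′) → ε ≡ ε′
  in-distinct {ε} {ε′} (same-lab , same-tgt) with contained
  ... | _ , σ , p , perm , occ = out-distinct (same-lab , Occ.vertex-injective occ _ _ (perm _ _ _
    (trans (occ-follows occ ε) (trans (cong (vmap p) same-tgt)
      (trans (sym (occ-follows occ ε′)) (cong (λ l → σ l (vmap p (src T ε′))) (sym same-lab)))))))

  open DistinctArcs out-distinct

  module _ (n : ℕ) where

    M S P D B : ℕ
    M = length (allTuples n k)
    S = sum (map (λ σ → occurrences σ T) (allTuples n k))
    P = length (filter (λ σ → 1 ≤? occurrences σ T) (allTuples n k))
    D = length (solutions n doubleArcs)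
    B = length (tuplePairsWith {n} straddling?)

    S≡ : length (occPairs n) ≡ S
    S≡ = length-join _,_ occs (allTuples n k)

    second-moment : 2 * c * S ≤ 2 * c * c * P + (D + 2 * B)
    second-moment = begin
      2 * c * S
        ≤⟨ sum-bonferroni (λ σ → 1 ≤? occurrences σ T) (λ σ → occurrences σ T) (length ∘ pairsWith nonequivalent?) {2 * c} {2 * c * c} (allTuples n k)
             (λ σ≱1 → n<1⇒n≡0 (≰⇒> σ≱1))
             (λ {σ} σ∈ → Bonferroni.bonferroni equiv? (λ {p} {q} → equiv-sym p q) (λ {p} {q} {s} → equiv-trans p q s) (occs σ)
               (length-class-≤ connected (subst (v ≤_) (sym order) (m≤n+m v r)) (tuples-perm σ∈))) ⟩
      2 * c * c * P + sum (map (length ∘ pairsWith nonequivalent?) (allTuples n k))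
        ≡⟨ cong (2 * c * c * P +_) (length-join _,_ (pairsWith nonequivalent?) (allTuples n k)) ⟨
      2 * c * c * P + length (tuplePairsWith {n} nonequivalent?)
        ≤⟨ +-monoʳ-≤ (2 * c * c * P) (length-nonequivalent-≤ n) ⟩
      2 * c * c * P + (D + 2 * B) ∎
      where open ≤-Reasoning

  -- `C₂ ≤ n` is the size condition of `mean-upper` for two copies and implies the one for a single
  -- copy; `4 * v ≤ n` makes `n - 2v` at least half of `n`; the successor keeps `n` nonzero.
  threshold : ℕ
  threshold = suc (C₂ + 4 * v)

  module Large (n : ℕ) (large : threshold ≤ n) where

    open ≤-Reasoning

    instance
      n≢0 : NonZero n
      n≢0 = Data.Nat.>-nonZero (≤-trans (s≤s z≤n) large)
      M≢0 : NonZero (M n)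
      M≢0 = Data.Nat.>-nonZero (tuples-nonempty n k)
      A≢0 : NonZero (n ^ r)
      A≢0 = m^n≢0 n r

    C₂≤n : C₂ ≤ n
    C₂≤n = ≤-trans (m≤m+n C₂ (4 * v)) (≤-trans (n≤1+n _) large)

    C₀≤n : C₀ ≤ n
    C₀≤n = ≤-trans (*-monoʳ-≤ 2 (*-mono-≤ (m≤m+n e e) (m≤m+n e e))) C₂≤n

    4v≤n : 4 * v ≤ n
    4v≤n = ≤-trans (m≤n+m (4 * v) C₂) (≤-trans (n≤1+n _) large)

    upper : S n * n ^ r * n ≤ M n * n + C₀ * M n
    upper = mean-upper (S n) (M n) r v order (begin
      (n ∸ e) ^ e * S n                                     ≡⟨ cong (λ s → (n ∸ e) ^ e * s) (S≡ n) ⟨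
      (n ∸ e) ^ e * length (occPairs n)                     ≤⟨ *-monoʳ-≤ ((n ∸ e) ^ e) (occPairs≤solutions n) ⟩
      (n ∸ e) ^ e * length (solutions n arcs)               ≡⟨ cong (λ j → (n ∸ e) ^ j * length (solutions n arcs)) length-arcs ⟨
      (n ∸ e) ^ length arcs * length (solutions n arcs)     ≤⟨ length-solutions-≤ n arcs out-pairs (≤-reflexive length-arcs) ⟩
      n ^ v * M n                                           ∎) C₀≤n

    lower : M n * n ≤ S n * n ^ r * n + C₁ * M n
    lower = mean-lower (S n) (M n) r v (begin
      (n ∸ v) ^ v * M n                                     ≤⟨ length-solutions-≥ n arcs out-pairs in-pairs ⟩
      n ^ length arcs * length (solutions n arcs)           ≡⟨ cong (λ j → n ^ j * length (solutions n arcs)) (trans length-arcs order) ⟩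
      n ^ (r + v) * length (solutions n arcs)               ≤⟨ *-monoʳ-≤ (n ^ (r + v)) (solutions≤occPairs n) ⟩
      n ^ (r + v) * length (occPairs n)                     ≡⟨ cong (n ^ (r + v) *_) (S≡ n) ⟩
      n ^ (r + v) * S n                                     ∎)
      where
      in-pairs : AllPairs (λ c c′ → ¬ SameIn c c′) arcs
      in-pairs = AllPairsP.tabulate⁺ (λ ε≢ε′ same → ε≢ε′ (in-distinct same))

    n^2r : n ^ (2 * r) ≡ n ^ r * n ^ r
    n^2r = trans (cong (λ j → n ^ (r + j)) (+-identityʳ r)) (^-distribˡ-+-* n r r)

    disjoint : D n * (n ^ r * n ^ r) * n ≤ M n * n + C₂ * M n
    disjoint = subst (λ p → D n * p * n ≤ M n * n + C₂ * M n) n^2r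
      (mean-upper (D n) (M n) (2 * r) (v + v) (trans (cong₂ _+_ order order) (eq r v)) (begin
        (n ∸ (e + e)) ^ (e + e) * D n                       ≡⟨ cong (λ j → (n ∸ (e + e)) ^ j * D n) length-doubleArcs ⟨
        (n ∸ (e + e)) ^ length doubleArcs * D n             ≤⟨ length-solutions-≤ n doubleArcs (doubleArcs-distinct out-pairs) (≤-reflexive length-doubleArcs) ⟩
        n ^ (v + v) * M n                                   ∎) C₂≤n)
      where
      eq : ∀ r v → r + v + (r + v) ≡ 2 * r + (v + v)
      eq = solve-∀

    straddle : B n * n ^ r * n ≤ C₃ * M n
    straddle = *-cancelʳ-≤ (B n * n ^ r * n) (C₃ * M n) n (begin
      B n * n ^ r * n * n                        ≡⟨ eq₁ (B n) (n ^ r) n ⟩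
      n * B n * (n ^ r * n)                      ≤⟨ *-monoˡ-≤ (n ^ r * n) few ⟩
      2 * (K * S n) * (n ^ r * n)                ≡⟨ eq₂ K (S n) (n ^ r) n ⟩
      2 * K * (S n * n ^ r * n)                  ≤⟨ *-monoʳ-≤ (2 * K) upper ⟩
      2 * K * (M n * n + C₀ * M n)               ≤⟨ *-monoʳ-≤ (2 * K) (+-monoʳ-≤ (M n * n) (*-monoˡ-≤ (M n) C₀≤n)) ⟩
      2 * K * (M n * n + n * M n)                ≡⟨ eq₃ K (M n) n ⟩
      4 * K * M n * n                            ∎)
      where
      K = length tags
      m = n ∸ (v + v)
      n≤2m : n ≤ 2 * m
      n≤2m = begin
        n              ≤⟨ m≤n+m∸n n (v + v) ⟩
        v + v + m      ≤⟨ +-monoˡ-≤ m (m+n≤o⇒m≤o∸n (v + v) (≤-trans (≤-reflexive (eq v)) 4v≤n)) ⟩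
        m + m          ≡⟨ cong (m +_) (+-identityʳ m) ⟨
        2 * m          ∎
        where
        eq : ∀ v → v + v + (v + v) ≡ 4 * v
        eq = solve-∀
      few : n * B n ≤ 2 * (K * S n)
      few = begin
        n * B n                              ≤⟨ *-monoˡ-≤ (B n) n≤2m ⟩
        2 * m * B n                          ≡⟨ *-assoc 2 m (B n) ⟩
        2 * (m * B n)                        ≤⟨ *-monoʳ-≤ 2 (length-straddling-≤ connected n) ⟩
        2 * (K * length (occPairs n))        ≡⟨ cong (λ s → 2 * (K * s)) (S≡ n) ⟩
        2 * (K * S n)                        ∎
      eq₁ : ∀ B A n → B * A * n * n ≡ n * B * (A * n)
      eq₁ = solve-∀
      eq₂ : ∀ K S A n → 2 * (K * S) * (A * n) ≡ 2 * K * (S * A * n)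
      eq₂ = solve-∀
      eq₃ : ∀ K M n → 2 * K * (M * n + n * M) ≡ 4 * K * M * n
      eq₃ = solve-∀

    expectation : ∣ expectedOcc T n -ℚ invPow n r ∣ ≤ℚ ratio (C₀ + C₁) 1 *ℚ invPow n (suc r)
    expectation = first-moment-ℚ {S n} {C₀ = C₀} {C₁} upper lower

    probability : (ratio 1 (c * n ^ r) -ℚ ratio 1 (2 * c * c * n ^ (2 * r)) -ℚ ratio (C₁ + C₂ + C₃) 1 *ℚ invPow n (suc r)) ≤ℚ probOcc T n
    probability = second-moment-ℚ {P n} {M n} {n} {n ^ r} {c * n ^ r} {2 * c * c * n ^ (2 * r)} {C₁ + C₂ + C₃}
      (subst (λ p → let Q = 2 * c * c * p in M n * Q * (n * n ^ r) ≤ ((P n * Q + M n) * (n * n ^ r) + (C₁ + C₂ + C₃) * (M n * Q)) * (c * n ^ r))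
        (sym n^2r)
        (combine-bounds {c} {n} {n ^ r} {M n} {S n} {P n} {D n} {B n} {C₁} {C₂} {C₃} automorphisms-nonempty (m^n>0 n r) lower (second-moment n) disjoint straddle))
      where
      instance
        c≢0 : NonZero c
        c≢0 = Data.Nat.>-nonZero automorphisms-nonempty
        X≢0 : NonZero (c * n ^ r)
        X≢0 = m*n≢0 c (n ^ r)
        Q≢0 : NonZero (2 * c * c * n ^ (2 * r))
        Q≢0 = m*n≢0 (2 * c * c) (n ^ (2 * r)) {{m*n≢0 (2 * c) c {{m*n≢0 2 c}}}} {{m^n≢0 n (2 * r)}}

theorem4p7 : (d k : ℕ) → d ≡ 2 * k → 4 ≤ d →
    (T : LGraph k) → IsTangle T →
    (r : ℕ) → nE T ≡ r + nV T →
    (∃[ C ] ∃[ N ] ∀ n → N ≤ n →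
        ∣ expectedOcc T n -ℚ invPow n r ∣ ≤ℚ C *ℚ invPow n (suc r))
    ×
    (∃[ C ] ∃[ N ] ∀ n → N ≤ n →
        (ratio 1 (pruningAutCount T * n ^ r)
          -ℚ ratio 1 (2 * pruningAutCount T * pruningAutCount T * n ^ (2 * r))
          -ℚ C *ℚ invPow n (suc r))
        ≤ℚ probOcc T n)
theorem4p7 _ k _ _ T tangle r order =
  (ratio (C₀ + C₁) 1 , threshold , Large.expectation) , (ratio (C₁ + C₂ + C₃) 1 , threshold , Large.probability)
  where open Moments T tangle r order
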